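{- Let $n,k$ be positive integers, let $S\subseteq\{0,1,\dots,k-2\}$ be nonempty with $t:=\max(S)$, and let $n\geq\max(3k-2t+1,2k+1)$. Then \[Z(J_S(n,k))\le Z_t(J_S(n,k))\le Z_c(J_S(n,k))\le\binom{n}{k}-\binom{2k-2t}{k-t}.\] If $S=\{0,1,\dots,t\}$, then equality holds throughout.
   Context: For $S\subseteq\{0,1,\dots,k-1\}$, the generalized Johnson graph $J_S(n,k)$ is the simple graph whose vertices are the $k$-element subsets of $\{1,\dots,n\}$, two distinct vertices being adjacent if and only if the size of their intersection lies in $S$. Zero forcing on a graph $G$: start with a set of black vertices, all others white; repeatedly, if a black vertex $v$ has exactly one white neighbor $w$, color $w$ black. A set of initially black vertices is a zero forcing set if this process eventually colors all vertices black. $Z(G)$ is the minimum size of a zero forcing set; $Z_t(G)$ is the minimum size of a zero forcing set $B$ such that the induced subgraph $G[B]$ has no isolated vertices; $Z_c(G)$ is the minimum size of a zero forcing set $B$ such that $G[B]$ is connected. -}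

module Defs where

open import Data.Nat using (ℕ; _≤_; _+_; _*_; _∸_)
open import Data.Nat.Combinatorics using (_C_)
open import Data.Fin using (Fin; toℕ)
open import Data.Fin.Subset using (Subset; _∈_; _∩_; ∣_∣)
open import Data.List using (List; length)
open import Data.List.Membership.Propositional renaming (_∈_ to _∈ₗ_)
open import Data.List.Relation.Unary.All using (All)
open import Data.List.Relation.Unary.Unique.Propositional using (Unique)
open import Data.Product using (Σ; _×_; ∃; ∃-syntax)
open import Relation.Binary.PropositionalEquality using (_≡_; _≢_)

-- Generalized Johnson graph J_S(n,k).
-- Vertices: k-element subsets of an n-element ground set (Fin n), i.e. u : Subset n with ∣ u ∣ ≡ k.
-- S ⊆ {0,…,k-1} is represented as S : Subset k  (element i : Fin k stands for the number toℕ i).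

IsVtx : (n k : ℕ) → Subset n → Set
IsVtx n k u = ∣ u ∣ ≡ k

Adj : (n k : ℕ) → Subset k → Subset n → Subset n → Set
Adj n k S u v = u ≢ v × Σ (Fin k) (λ i → i ∈ S × toℕ i ≡ ∣ u ∩ v ∣)

data Black (n k : ℕ) (S : Subset k) (B : List (Subset n)) : Subset n → Set where
  init  : ∀ {v} → v ∈ₗ B → Black n k S B v
  force : ∀ {u w} → IsVtx n k u → Black n k S B u → IsVtx n k w → Adj n k S u w →
          (∀ x → IsVtx n k x → Adj n k S u x → x ≢ w → Black n k S B x) →
          Black n k S B w

ZeroForcing : (n k : ℕ) → Subset k → List (Subset n) → Set
ZeroForcing n k S B = All (IsVtx n k) B × Unique B × (∀ v → IsVtx n k v → Black n k S B v)

NoIsolated : (n k : ℕ) → Subset k → List (Subset n) → Set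
NoIsolated n k S B = ∀ u → u ∈ₗ B → ∃[ v ] (v ∈ₗ B × Adj n k S u v)

data Reach (n k : ℕ) (S : Subset k) (B : List (Subset n)) (u : Subset n) : Subset n → Set where
  here : Reach n k S B u u
  step : ∀ {w w'} → Reach n k S B u w → w' ∈ₗ B → Adj n k S w w' → Reach n k S B u w'

Connected : (n k : ℕ) → Subset k → List (Subset n) → Set
Connected n k S B = ∀ u v → u ∈ₗ B → v ∈ₗ B → Reach n k S B u v

IsMinimum : (ℕ → Set) → ℕ → Set
IsMinimum P m = P m × (∀ m' → P m' → m ≤ m')

ZFSize : (n k : ℕ) → Subset k → (List (Subset n) → Set) → ℕ → Set
ZFSize n k S Q m = ∃[ B ] (ZeroForcing n k S B × Q B × length B ≡ m)

record Trivial : Set where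

IsZ : (n k : ℕ) → Subset k → ℕ → Set
IsZ n k S = IsMinimum (ZFSize n k S (λ _ → Trivial))

IsZt : (n k : ℕ) → Subset k → ℕ → Set
IsZt n k S = IsMinimum (ZFSize n k S (NoIsolated n k S))

IsZc : (n k : ℕ) → Subset k → ℕ → Set
IsZc n k S = IsMinimum (ZFSize n k S (Connected n k S))

IsMax : (k : ℕ) → Subset k → ℕ → Set
IsMax k S t = Σ (Fin k) (λ i → i ∈ S × toℕ i ≡ t) × (∀ i → i ∈ S → toℕ i ≤ t)

bound : (n k t : ℕ) → ℕ
bound n k t = (n C k) ∸ ((2 * k ∸ 2 * t) C (k ∸ t))

{-# OPTIONS --safe #-}
module Submission where

-- Put d = k − t.
--
-- Lower bound for S = {0,…,t}.  If uᵢ forces wᵢ at time i, then |uᵢ ∩ wᵢ| ≤ t while |uᵢ ∩ wⱼ| > t for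
-- j > i, so the forces form a skew set-pair system and it suffices to show that it has at most
-- (2d choose d) members.  Choose integers yₓ and put p_A = ∏_{x ∈ A} (1 − yₓ z).  The wedge of the 2d
-- vectors zʲ p_A, zʲ p_B (j < d) modulo z²ᵈ is a bilinear pairing of an element of Λᵈ(ℤ²ᵈ) depending on A
-- with one depending on B.  It vanishes if |A ∩ B| > t, because p_A and p_B then have more than t common
-- factors; if |A ∩ B| ≤ t it is nonzero for suitable y, hence for generic y.  So the pairing matrix of
-- the system is triangular with nonzero diagonal, and has rank at most dim Λᵈ(ℤ²ᵈ).
--
-- Upper bound.  Fix T with |T| = t, a point o ∉ T, and sets M, M′ ⊇ T ∪ {o} of size t + 2d with
-- |M ∩ M′| < k.  Initially white are the k-sets w with T ⊆ w ⊆ M, o ∉ w and those with T ⊆ w ⊆ M′, o ∈ w.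
-- Each w of the first kind is forced by T ∪ (M ∖ w), and then each w of the second kind by T ∪ (M′ ∖ w).
-- The remaining vertices induce a connected graph, because two vertices differing by an exchange of
-- elements have a common black neighbour.

-- The pairing must live in dimension 2d although the sets have k elements of an n-element ground
-- set. Truncation modulo z²ᵈ achieves this: since p_{B∖A} has constant term 1, the relation p_{B∖A}
-- p_A = p_{A∖B} p_B remains a nontrivial dependence after truncation. The natural white family, all
-- k-sets between T and a single M of size t + 2d, has the right size, but it is closed under w ↦ T
-- ∪ (M ∖ w), so every intended forcer would itself be white. Splitting it at o and moving one half
-- to M′ keeps the count, and |M ∩ M′| < k makes the forcers of the first half black. The least n
-- with room for M and M′ is (k - 1) + 2(d + 1) = 3k - 2t + 1. The theorem asserts that the three
-- minima exist. Constructively this calls for deciding whether a list is a zero forcing set, and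
-- blackness and reachability are inductively defined closures; hence a part on decision procedures.
-- Finally, Z_t ≤ Z_c requires that a connected zero forcing set is never a single vertex, which
-- holds because every vertex has two neighbours.

-- Exterior powers of ℤᴺ in coordinates.

module ExteriorPower where

  open import Data.Nat as ℕ using (ℕ; zero; suc)
  open import Data.Integer using (ℤ; 0ℤ; 1ℤ; -1ℤ; _+_; _*_)
  import Data.Integer.Properties as ℤₚ
  open import Data.Integer.Tactic.RingSolver using (solve-∀)
  open import Data.Vec using (Vec; []; _∷_)
  open import Data.Vec.Relation.Unary.Any using (here; there)
  open import Data.Vec.Membership.Propositional using (_∈_)
  open import Function using (_∘_)
  open import Relation.Binary.PropositionalEquality

  -- A sequence stands for its first N entries, N being that of the Λ N a it acts on.
  Seq : Set
  Seq = ℕ → ℤ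

  -- Λ N a is the a-th exterior power of ℤᴺ; x ⊕ y means x + e₀ ∧ y, where x and y do not involve e₀.
  data Λ : ℕ → ℕ → Set where
    scalar : ∀ {N} → ℤ → Λ N 0
    none   : ∀ {a} → Λ 0 (suc a)
    _⊕_    : ∀ {N a} → Λ N (suc a) → Λ N a → Λ (suc N) (suc a)

  private variable
    N a b : ℕ

  -- One operation for sums, multiples and negatives, so that linearity of a map is a single
  -- equation.
  comb : ℤ → Λ N a → ℤ → Λ N a → Λ N a
  comb c (scalar x) d (scalar y) = scalar (c * x + d * y)
  comb c none       d none       = none
  comb c (x ⊕ y)    d (x′ ⊕ y′)  = comb c x d x′ ⊕ comb c y d y′

  0Λ : Λ N a
  0Λ {N}     {zero}  = scalar 0ℤ
  0Λ {zero}  {suc a} = none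
  0Λ {suc N} {suc a} = 0Λ ⊕ 0Λ

  infixr 7 _∧_
  -- With v = v₀ e₀ + v′, the product v ∧ (x + e₀ ∧ y) equals v′ ∧ x + e₀ ∧ (v₀ x - v′ ∧ y); the
  -- sign comes from moving v′ past e₀.
  _∧_ : Seq → Λ N a → Λ N (suc a)
  _∧_ {zero}  v (scalar x) = none
  _∧_ {suc N} v (scalar x) = ((v ∘ suc) ∧ scalar x) ⊕ scalar (v 0 * x)
  v ∧ none    = none
  v ∧ (x ⊕ y) = ((v ∘ suc) ∧ x) ⊕ comb (v 0) x -1ℤ ((v ∘ suc) ∧ y)

  comb-interchange : ∀ p q c d (x x′ y y′ : Λ N a) →
    comb p (comb c x d x′) q (comb c y d y′) ≡ comb c (comb p x q y) d (comb p x′ q y′)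
  comb-interchange p q c d (scalar x) (scalar x′) (scalar y) (scalar y′) =
    cong scalar (identity p q c d x x′ y y′)
    where
    identity : ∀ p q c d x x′ y y′ →
      p * (c * x + d * x′) + q * (c * y + d * y′) ≡ c * (p * x + q * y) + d * (p * x′ + q * y′)
    identity = solve-∀
  comb-interchange p q c d none none none none = refl
  comb-interchange p q c d (x ⊕ u) (x′ ⊕ u′) (y ⊕ w) (y′ ⊕ w′) =
    cong₂ _⊕_ (comb-interchange p q c d x x′ y y′) (comb-interchange p q c d u u′ w w′)

  comb-left-linear : ∀ c d p q (x V W : Λ N a) →
    comb (c * p + d * q) x -1ℤ (comb c V d W) ≡ comb c (comb p x -1ℤ V) d (comb q x -1ℤ W)
  comb-left-linear c d p q (scalar x) (scalar V) (scalar W) = cong scalar (identity c d p q x V W)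
    where
    identity : ∀ c d p q x V W →
      (c * p + d * q) * x + -1ℤ * (c * V + d * W) ≡ c * (p * x + -1ℤ * V) + d * (q * x + -1ℤ * W)
    identity = solve-∀
  comb-left-linear c d p q none none none = refl
  comb-left-linear c d p q (x ⊕ y) (V ⊕ V′) (W ⊕ W′) =
    cong₂ _⊕_ (comb-left-linear c d p q x V W) (comb-left-linear c d p q y V′ W′)

  comb-cancel : ∀ c (X : Λ N a) → comb c X -1ℤ (comb c X -1ℤ 0Λ) ≡ 0Λ
  comb-cancel c (scalar x) = cong scalar (identity c x)
    where
    identity : ∀ c x → c * x + -1ℤ * (c * x + -1ℤ * 0ℤ) ≡ 0ℤ
    identity = solve-∀
  comb-cancel c none = refl
  comb-cancel c (x ⊕ y) = cong₂ _⊕_ (comb-cancel c x) (comb-cancel c y)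

  comb-0 : ∀ c d → comb {N} {a} c 0Λ d 0Λ ≡ 0Λ
  comb-0 {N}     {zero}  c d = cong scalar (identity c d)
    where
    identity : ∀ c d → c * 0ℤ + d * 0ℤ ≡ 0ℤ
    identity = solve-∀
  comb-0 {zero}  {suc a} c d = refl
  comb-0 {suc N} {suc a} c d = cong₂ _⊕_ (comb-0 c d) (comb-0 c d)

  comb-identityʳ : (X : Λ N a) → comb 1ℤ X 1ℤ 0Λ ≡ X
  comb-identityʳ (scalar x) = cong scalar (identity x)
    where
    identity : ∀ x → 1ℤ * x + 1ℤ * 0ℤ ≡ x
    identity = solve-∀
  comb-identityʳ none = refl
  comb-identityʳ (x ⊕ y) = cong₂ _⊕_ (comb-identityʳ x) (comb-identityʳ y)

  ∧-zeroʳ : ∀ v → v ∧ 0Λ {N} {a} ≡ 0Λ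
  ∧-zeroʳ {zero}  {zero}  v = refl
  ∧-zeroʳ {suc N} {zero}  v = cong₂ _⊕_ (∧-zeroʳ (v ∘ suc)) (cong scalar (ℤₚ.*-zeroʳ (v 0)))
  ∧-zeroʳ {zero}  {suc a} v = refl
  ∧-zeroʳ {suc N} {suc a} v = cong₂ _⊕_ (∧-zeroʳ (v ∘ suc))
    (trans (cong (comb (v 0) 0Λ -1ℤ) (∧-zeroʳ (v ∘ suc))) (comb-0 (v 0) -1ℤ))

  ∧-comb : ∀ v c d (x y : Λ N a) → v ∧ comb c x d y ≡ comb c (v ∧ x) d (v ∧ y)
  ∧-comb {zero}  v c d (scalar x) (scalar y) = refl
  ∧-comb {suc N} v c d (scalar x) (scalar y) =
    cong₂ _⊕_ (∧-comb (v ∘ suc) c d (scalar x) (scalar y)) (cong scalar (identity (v 0) c d x y))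
    where
    identity : ∀ v c d x y → v * (c * x + d * y) ≡ c * (v * x) + d * (v * y)
    identity = solve-∀
  ∧-comb v c d none none = refl
  ∧-comb v c d (x ⊕ y) (x′ ⊕ y′) = cong₂ _⊕_ (∧-comb (v ∘ suc) c d x x′)
    (trans (cong (comb (v 0) (comb c x d x′) -1ℤ) (∧-comb (v ∘ suc) c d y y′))
           (comb-interchange (v 0) -1ℤ c d x x′ ((v ∘ suc) ∧ y) ((v ∘ suc) ∧ y′)))

  comb-∧ : ∀ c d v w (x : Λ N a) → (λ i → c * v i + d * w i) ∧ x ≡ comb c (v ∧ x) d (w ∧ x)
  comb-∧ {zero}  c d v w (scalar x) = refl
  comb-∧ {suc N} c d v w (scalar x) =
    cong₂ _⊕_ (comb-∧ c d (v ∘ suc) (w ∘ suc) (scalar x)) (cong scalar (identity (v 0) (w 0) c d x))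
    where
    identity : ∀ v w c d x → (c * v + d * w) * x ≡ c * (v * x) + d * (w * x)
    identity = solve-∀
  comb-∧ c d v w none = refl
  comb-∧ c d v w (x ⊕ y) = cong₂ _⊕_ (comb-∧ c d (v ∘ suc) (w ∘ suc) x)
    (trans (cong (comb (c * v 0 + d * w 0) x -1ℤ) (comb-∧ c d (v ∘ suc) (w ∘ suc) y))
           (comb-left-linear c d (v 0) (w 0) x ((v ∘ suc) ∧ y) ((w ∘ suc) ∧ y)))

  ∧-congˡ : ∀ {v w} → v ≗ w → (x : Λ N a) → v ∧ x ≡ w ∧ x
  ∧-congˡ {zero}  eq (scalar x) = refl
  ∧-congˡ {suc N} eq (scalar x) = cong₂ _⊕_ (∧-congˡ (eq ∘ suc) (scalar x)) (cong (λ c → scalar (c * x)) (eq 0))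
  ∧-congˡ eq none = refl
  ∧-congˡ eq (x ⊕ y) = cong₂ _⊕_ (∧-congˡ (eq ∘ suc) x)
    (cong₂ (λ c z → comb c x -1ℤ z) (eq 0) (∧-congˡ (eq ∘ suc) y))

  -- The part free of e₀ is the same claim one dimension lower. In the e₀ part the two copies of v₀
  -- (v′ ∧ x) cancel and leave v′ ∧ v′ ∧ y.
  ∧-alternating : ∀ v (x : Λ N a) → v ∧ v ∧ x ≡ 0Λ
  ∧-alternating {zero}  v (scalar x) = refl
  ∧-alternating {suc N} v (scalar x) = cong₂ _⊕_ (∧-alternating (v ∘ suc) (scalar x)) (lemma (v ∘ suc) (v 0) x)
    where
    lemma : ∀ {N} w c x → comb {N} c (w ∧ scalar x) -1ℤ (w ∧ scalar (c * x)) ≡ 0Λ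
    lemma {zero}  w c x = refl
    lemma {suc N} w c x = cong₂ _⊕_ (lemma (w ∘ suc) c x) (cong scalar (identity c (w 0) x))
      where
      identity : ∀ c w x → c * (w * x) + -1ℤ * (w * (c * x)) ≡ 0ℤ
      identity = solve-∀
  ∧-alternating v none = refl
  ∧-alternating v (x ⊕ y) = cong₂ _⊕_ (∧-alternating v′ x) (begin
    comb (v 0) (v′ ∧ x) -1ℤ (v′ ∧ comb (v 0) x -1ℤ (v′ ∧ y))
      ≡⟨ cong (comb (v 0) (v′ ∧ x) -1ℤ) (∧-comb v′ (v 0) -1ℤ x (v′ ∧ y)) ⟩
    comb (v 0) (v′ ∧ x) -1ℤ (comb (v 0) (v′ ∧ x) -1ℤ (v′ ∧ v′ ∧ y))
      ≡⟨ cong (λ z → comb (v 0) (v′ ∧ x) -1ℤ (comb (v 0) (v′ ∧ x) -1ℤ z)) (∧-alternating v′ y) ⟩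
    comb (v 0) (v′ ∧ x) -1ℤ (comb (v 0) (v′ ∧ x) -1ℤ 0Λ)
      ≡⟨ comb-cancel (v 0) (v′ ∧ x) ⟩
    0Λ ∎)
    where
    open ≡-Reasoning
    v′ : Seq
    v′ = v ∘ suc

  -- Polarisation of ∧-alternating.
  ∧-anticommute : ∀ v w (x : Λ N a) → comb 1ℤ (v ∧ w ∧ x) 1ℤ (w ∧ v ∧ x) ≡ 0Λ
  ∧-anticommute v w x = begin
    comb 1ℤ (v ∧ w ∧ x) 1ℤ (w ∧ v ∧ x)
      ≡⟨ expand (v ∧ v ∧ x) (w ∧ w ∧ x) (v ∧ w ∧ x) (w ∧ v ∧ x) (∧-alternating v x) (∧-alternating w x) ⟩
    comb 1ℤ (comb 1ℤ (v ∧ v ∧ x) 1ℤ (v ∧ w ∧ x)) 1ℤ (comb 1ℤ (w ∧ v ∧ x) 1ℤ (w ∧ w ∧ x))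
      ≡⟨ cong₂ (λ y z → comb 1ℤ y 1ℤ z) (∧-comb v 1ℤ 1ℤ (v ∧ x) (w ∧ x)) (∧-comb w 1ℤ 1ℤ (v ∧ x) (w ∧ x)) ⟨
    comb 1ℤ (v ∧ comb 1ℤ (v ∧ x) 1ℤ (w ∧ x)) 1ℤ (w ∧ comb 1ℤ (v ∧ x) 1ℤ (w ∧ x))
      ≡⟨ comb-∧ 1ℤ 1ℤ v w (comb 1ℤ (v ∧ x) 1ℤ (w ∧ x)) ⟨
    s ∧ comb 1ℤ (v ∧ x) 1ℤ (w ∧ x)
      ≡⟨ cong (s ∧_) (comb-∧ 1ℤ 1ℤ v w x) ⟨
    s ∧ s ∧ x
      ≡⟨ ∧-alternating s x ⟩
    0Λ ∎
    where
    open ≡-Reasoning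
    s : Seq
    s i = 1ℤ * v i + 1ℤ * w i
    zeros : ∀ {N a} (P Q : Λ N a) → comb 1ℤ P 1ℤ Q ≡ comb 1ℤ (comb 1ℤ 0Λ 1ℤ P) 1ℤ (comb 1ℤ Q 1ℤ 0Λ)
    zeros (scalar P) (scalar Q) = cong scalar (identity P Q)
      where
      identity : ∀ P Q → 1ℤ * P + 1ℤ * Q ≡ 1ℤ * (1ℤ * 0ℤ + 1ℤ * P) + 1ℤ * (1ℤ * Q + 1ℤ * 0ℤ)
      identity = solve-∀
    zeros none none = refl
    zeros (P ⊕ P′) (Q ⊕ Q′) = cong₂ _⊕_ (zeros P Q) (zeros P′ Q′)
    expand : ∀ {N a} (A B P Q : Λ N a) → A ≡ 0Λ → B ≡ 0Λ →
      comb 1ℤ P 1ℤ Q ≡ comb 1ℤ (comb 1ℤ A 1ℤ P) 1ℤ (comb 1ℤ Q 1ℤ B)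
    expand _ _ P Q refl refl = zeros P Q

  -- In `x ⊕ y` the summand x lies in Λᴺ⁺¹(ℤᴺ) = 0, so the top coefficient sits in y.
  det : Λ N N → ℤ
  det (scalar x) = x
  det (x ⊕ y)    = det y

  det-comb : ∀ c d (x y : Λ N N) → det (comb c x d y) ≡ c * det x + d * det y
  det-comb c d (scalar x) (scalar y) = refl
  det-comb c d (x ⊕ y) (x′ ⊕ y′)     = det-comb c d y y′

  det-0 : det {N} 0Λ ≡ 0ℤ
  det-0 {zero}  = refl
  det-0 {suc N} = det-0 {N}

  wedgeOn : Vec Seq b → Λ N a → Λ N (b ℕ.+ a)
  wedgeOn []       x = x
  wedgeOn (v ∷ vs) x = v ∧ wedgeOn vs x

  wedge : Vec Seq a → Λ N a
  wedge []       = scalar 1ℤ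
  wedge (v ∷ vs) = v ∧ wedge vs

  wedgeOn-comb : ∀ (vs : Vec Seq b) c d (x y : Λ N a) →
    wedgeOn vs (comb c x d y) ≡ comb c (wedgeOn vs x) d (wedgeOn vs y)
  wedgeOn-comb []       c d x y = refl
  wedgeOn-comb (v ∷ vs) c d x y =
    trans (cong (v ∧_) (wedgeOn-comb vs c d x y)) (∧-comb v c d (wedgeOn vs x) (wedgeOn vs y))

  Annihilates : Λ N a → Seq → Set
  Annihilates x v = v ∧ x ≡ 0Λ

  -- Since v ∧ w ∧ x = - w ∧ v ∧ x, a repeated vector kills a wedge wherever its two copies stand.
  annihilates-∧ : ∀ {x : Λ N a} {v} w → Annihilates x v → Annihilates (w ∧ x) v
  annihilates-∧ {x = x} {v} w ann = begin
    v ∧ w ∧ x                            ≡⟨ comb-identityʳ (v ∧ w ∧ x) ⟨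
    comb 1ℤ (v ∧ w ∧ x) 1ℤ 0Λ            ≡⟨ cong (comb 1ℤ (v ∧ w ∧ x) 1ℤ) (trans (cong (w ∧_) ann) (∧-zeroʳ w)) ⟨
    comb 1ℤ (v ∧ w ∧ x) 1ℤ (w ∧ v ∧ x)   ≡⟨ ∧-anticommute v w x ⟩
    0Λ ∎
    where open ≡-Reasoning

  annihilates-wedgeOn : ∀ {x : Λ N a} {v} (ws : Vec Seq b) → Annihilates x v → Annihilates (wedgeOn ws x) v
  annihilates-wedgeOn []       ann = ann
  annihilates-wedgeOn (w ∷ ws) ann = annihilates-∧ w (annihilates-wedgeOn ws ann)

  ∈-annihilates-wedgeOn : ∀ {x : Λ N a} {v} (ws : Vec Seq b) → v ∈ ws → Annihilates (wedgeOn ws x) v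
  ∈-annihilates-wedgeOn (w ∷ ws) (here refl) = ∧-alternating w (wedgeOn ws _)
  ∈-annihilates-wedgeOn (w ∷ ws) (there v∈)  = annihilates-∧ w (∈-annihilates-wedgeOn ws v∈)

  ∈-annihilates-wedge : ∀ {v} (ws : Vec Seq a) → v ∈ ws → Annihilates (wedge {N = N} ws) v
  ∈-annihilates-wedge (w ∷ ws) (here refl) = ∧-alternating w (wedge ws)
  ∈-annihilates-wedge (w ∷ ws) (there v∈)  = annihilates-∧ w (∈-annihilates-wedge ws v∈)

  -- Stands in for linear spans: the annihilator of a wedge contains the factors of the wedge, so
  -- closure under combinations shows that whatever depends on them is killed too. Sequences are
  -- functions compared pointwise, hence `respects`.
  record IsSubspace (P : Seq → Set) : Set where
    field
      respects : ∀ {v w} → v ≗ w → P v → P w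
      closed   : ∀ c d {v w} → P v → P w → P (λ i → c * v i + d * w i)

  annihilator-isSubspace : (x : Λ N a) → IsSubspace (Annihilates x)
  annihilator-isSubspace x = record
    { respects = λ eq ann → trans (sym (∧-congˡ eq x)) ann
    ; closed   = λ c d {v} {w} p q → trans (comb-∧ c d v w x) (trans (cong₂ (λ y z → comb c y d z) p q) (comb-0 c d))
    }

-- The rank bound for triangular pairing matrices.

module TriangularSystem where

  open import Data.Nat as ℕ using (ℕ; zero; suc; z≤n; s≤s)
  import Data.Nat.Properties as ℕₚ
  open import Data.Nat.Combinatorics using (_C_; nCn≡1; nCk≡nC[n∸k]; nCk+nC[k+1]≡[n+1]C[k+1])
  open import Data.Integer using (ℤ; 0ℤ; 1ℤ; _+_; _*_; -_; _≟_)
  import Data.Integer.Properties as ℤₚ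
  open import Data.Integer.Tactic.RingSolver using (solve-∀)
  open import Data.List as List using (List; []; _∷_; length)
  import Data.List.Properties as Listₚ
  open import Data.List.Relation.Unary.All as All using (All; []; _∷_)
  import Data.List.Relation.Unary.All.Properties as Allₚ
  open import Data.List.Relation.Unary.AllPairs as AllPairs using (AllPairs; []; _∷_)
  import Data.List.Relation.Unary.AllPairs.Properties as AllPairsₚ
  open import Data.Product using (∃; _×_; _,_; proj₂)
  open import Data.Sum using (inj₁; inj₂)
  open import Data.Vec as Vec using (Vec; []; _∷_; zipWith; replicate; tail; _++_; take; drop)
  import Data.Vec.Properties as Vecₚ
  open import Function using (_∘_)
  open import Relation.Nullary using (yes; no; contradiction)
  open import Relation.Binary.PropositionalEquality
  open ExteriorPower

  lincomb : ∀ {d} → ℤ → Vec ℤ d → ℤ → Vec ℤ d → Vec ℤ d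
  lincomb p x q y = zipWith (λ a b → p * a + q * b) x y

  record Functional (d : ℕ) : Set where
    field
      eval   : Vec ℤ d → ℤ
      linear : ∀ p q x y → eval (lincomb p x q y) ≡ p * eval x + q * eval y

  open Functional

  0⃗ : ∀ {d} → Vec ℤ d
  0⃗ = replicate _ 0ℤ

  e₀ : ∀ {d} → Vec ℤ (suc d)
  e₀ = 1ℤ ∷ 0⃗

  lincomb-0⃗ : ∀ {d} p (x : Vec ℤ d) → lincomb p 0⃗ 1ℤ x ≡ x
  lincomb-0⃗ p []      = refl
  lincomb-0⃗ p (x ∷ v) = cong₂ _∷_ (identity p x) (lincomb-0⃗ p v)
    where
    identity : ∀ p x → p * 0ℤ + 1ℤ * x ≡ x
    identity = solve-∀

  eval-∷ : ∀ {d} (φ : Functional (suc d)) x v → eval φ (x ∷ v) ≡ x * eval φ e₀ + eval φ (0ℤ ∷ v)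
  eval-∷ φ x v = begin
    eval φ (x ∷ v)                           ≡⟨ cong (eval φ) (cong₂ _∷_ (identity x) (sym (lincomb-0⃗ x v))) ⟩
    eval φ (lincomb x e₀ 1ℤ (0ℤ ∷ v))        ≡⟨ linear φ x 1ℤ e₀ (0ℤ ∷ v) ⟩
    x * eval φ e₀ + 1ℤ * eval φ (0ℤ ∷ v)     ≡⟨ cong (x * eval φ e₀ +_) (ℤₚ.*-identityˡ _) ⟩
    x * eval φ e₀ + eval φ (0ℤ ∷ v) ∎
    where
    open ≡-Reasoning
    identity : ∀ x → x ≡ x * 1ℤ + 1ℤ * 0ℤ
    identity = solve-∀

  restrict : ∀ {d} → Functional (suc d) → Functional d
  restrict φ = record
    { eval   = λ v → eval φ (0ℤ ∷ v)
    ; linear = λ p q x y → trans (cong (λ z → eval φ (z ∷ lincomb p x q y)) (sym (identity p q)))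
                                 (linear φ p q (0ℤ ∷ x) (0ℤ ∷ y))
    }
    where
    identity : ∀ p q → p * 0ℤ + q * 0ℤ ≡ 0ℤ
    identity = solve-∀

  -- The combination of φ and ψ that vanishes on e₀.
  eliminate : ∀ {d} → Functional (suc d) → Functional (suc d) → Functional d
  eliminate φ ψ = record
    { eval   = λ v → eval φ e₀ * eval ψ₀ v + - eval ψ e₀ * eval φ₀ v
    ; linear = λ p q x y → trans
        (cong₂ (λ a b → eval φ e₀ * a + - eval ψ e₀ * b) (linear ψ₀ p q x y) (linear φ₀ p q x y))
        (identity (eval φ e₀) (- eval ψ e₀) p q (eval ψ₀ x) (eval ψ₀ y) (eval φ₀ x) (eval φ₀ y))
    }
    where
    φ₀ = restrict φ
    ψ₀ = restrict ψ
    identity : ∀ c d p q a b a′ b′ →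
      c * (p * a + q * b) + d * (p * a′ + q * b′) ≡ p * (c * a + d * a′) + q * (c * b + d * b′)
    identity = solve-∀

  -- With c = φ(e₀) and e = ψ(e₀), the first coordinate x of v would contribute x (c e - e c) = 0,
  -- so dropping it is harmless; what remains is c ψ(v) - e φ(v) with φ(v) = 0. Elimination thus
  -- only scales the pairings by c.
  eliminate-tail : ∀ {d} (φ ψ : Functional (suc d)) v → eval φ v ≡ 0ℤ →
    eval (eliminate φ ψ) (tail v) ≡ eval φ e₀ * eval ψ v
  eliminate-tail φ ψ (x ∷ v) φv≡0 = begin
    c * eval ψ (0ℤ ∷ v) + - e * eval φ (0ℤ ∷ v)
      ≡⟨ identity c e x (eval ψ (0ℤ ∷ v)) (eval φ (0ℤ ∷ v)) ⟩
    c * (x * e + eval ψ (0ℤ ∷ v)) + - e * (x * c + eval φ (0ℤ ∷ v))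
      ≡⟨ cong₂ (λ a b → c * a + - e * b) (eval-∷ ψ x v) (trans (sym φv≡0) (eval-∷ φ x v)) ⟨
    c * eval ψ (x ∷ v) + - e * 0ℤ
      ≡⟨ cong (c * eval ψ (x ∷ v) +_) (ℤₚ.*-zeroʳ (- e)) ⟩
    c * eval ψ (x ∷ v) + 0ℤ
      ≡⟨ ℤₚ.+-identityʳ _ ⟩
    c * eval ψ (x ∷ v) ∎
    where
    open ≡-Reasoning
    c = eval φ e₀
    e = eval ψ e₀
    identity : ∀ c e x a b → c * a + - e * b ≡ c * (x * e + a) + - e * (x * c + b)
    identity = solve-∀

  System : ℕ → Set
  System d = List (Functional d × Vec ℤ d)

  Pairs≡0 : ∀ {d} → Functional d × Vec ℤ d → Functional d × Vec ℤ d → Set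
  Pairs≡0 (φ , _) (_ , y) = eval φ y ≡ 0ℤ

  Nondegenerate : ∀ {d} → Functional d × Vec ℤ d → Set
  Nondegenerate (φ , x) = eval φ x ≢ 0ℤ

  Triangular : ∀ {d} → System d → Set
  Triangular L = AllPairs Pairs≡0 L × All Nondegenerate L

  *-≢0 : ∀ {i j} → i ≢ 0ℤ → j ≢ 0ℤ → i * j ≢ 0ℤ
  *-≢0 {i} i≢0 j≢0 ij≡0 with ℤₚ.i*j≡0⇒i≡0∨j≡0 i ij≡0
  ... | inj₁ i≡0 = i≢0 i≡0
  ... | inj₂ j≡0 = j≢0 j≡0

  eval-tail : ∀ {d} (φ : Functional (suc d)) → eval φ e₀ ≡ 0ℤ → ∀ v → eval (restrict φ) (tail v) ≡ eval φ v
  eval-tail φ eq (x ∷ v) = sym (trans (eval-∷ φ x v)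
    (trans (cong (λ c → x * c + eval φ (0ℤ ∷ v)) eq)
           (trans (cong (_+ eval φ (0ℤ ∷ v)) (ℤₚ.*-zeroʳ x)) (ℤₚ.+-identityˡ _))))

  -- Pivot on the first functional not vanishing on e₀.
  drop-coordinate : ∀ {d} (L : System (suc d)) → Triangular L →
    ∃ λ (L′ : System d) → Triangular L′ × length L ℕ.≤ suc (length L′) ×
      (∀ {P : Vec ℤ d → Set} → All (P ∘ tail ∘ proj₂) L → All (P ∘ proj₂) L′)
  drop-coordinate [] _ = [] , ([] , []) , z≤n , λ _ → []
  drop-coordinate {d} ((φ , x) ∷ L) (φL ∷ LL , φx ∷ D) with eval φ e₀ ≟ 0ℤ
  ... | yes φe₀≡0 =
    -- The pivot lies further down. `inherit` transfers properties of the tails of the vectors of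
    -- `L` to the vectors of `L′`; this is how φ, put back in front, is known to vanish on all of
    -- them.
    let L′ , (T , D′) , len , inherit = drop-coordinate L (LL , D)
        restricted : All (λ (_ , y) → eval (restrict φ) (tail y) ≡ 0ℤ) L
        restricted = All.map (λ {(_ , y)} eq → trans (eval-tail φ φe₀≡0 y) eq) φL
    in (restrict φ , tail x) ∷ L′
     , (inherit {λ y → eval (restrict φ) y ≡ 0ℤ} restricted ∷ T
       , (λ eq → φx (trans (sym (eval-tail φ φe₀≡0 x)) eq)) ∷ D′)
     , s≤s len
     , λ { {P} (p ∷ ps) → p ∷ inherit {P} ps }
  ... | no φe₀≢0 =
    List.map f L
    , (AllPairsₚ.map⁺ (pairs φL LL) , Allₚ.map⁺ (diag φL D))
    , s≤s (ℕₚ.≤-reflexive (sym (Listₚ.length-map f L)))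
    , λ { (_ ∷ ps) → Allₚ.map⁺ ps }
    where
    f : Functional (suc d) × Vec ℤ (suc d) → Functional d × Vec ℤ d
    f (ψ , y) = eliminate φ ψ , tail y
    pairs : ∀ {M} → All (Pairs≡0 (φ , x)) M → AllPairs Pairs≡0 M →
      AllPairs (λ p q → Pairs≡0 (f p) (f q)) M
    pairs [] [] = []
    pairs {(ψ , _) ∷ _} (_ ∷ φM) (ψM ∷ MM) =
      All.zipWith (λ { {(_ , y)} (φy≡0 , ψy≡0) →
        trans (eliminate-tail φ ψ y φy≡0) (trans (cong (eval φ e₀ *_) ψy≡0) (ℤₚ.*-zeroʳ (eval φ e₀))) }) (φM , ψM)
      ∷ pairs φM MM
    diag : ∀ {M} → All (Pairs≡0 (φ , x)) M → All Nondegenerate M → All (Nondegenerate ∘ f) M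
    diag φM DM = All.zipWith (λ { {(ψ , y)} (φy≡0 , ψy≢0) eq →
      *-≢0 φe₀≢0 ψy≢0 (trans (sym (eliminate-tail φ ψ y φy≡0)) eq) }) (φM , DM)

  Functional₀-eval : (φ : Functional 0) → eval φ [] ≡ 0ℤ
  Functional₀-eval φ = linear φ 0ℤ 0ℤ [] []

  triangular⇒length≤ : ∀ {d} (L : System d) → Triangular L → length L ℕ.≤ d
  triangular⇒length≤ {zero} [] _ = z≤n
  triangular⇒length≤ {zero} ((φ , []) ∷ L) (_ , φx ∷ _) = contradiction (Functional₀-eval φ) φx
  triangular⇒length≤ {suc d} L T =
    let L′ , T′ , len , _ = drop-coordinate L T
    in ℕₚ.≤-trans len (s≤s (triangular⇒length≤ L′ T′))

  -- Follows the constructors of `Λ`, so that `flatten` needs no transport; Pascal's rule turns it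
  -- into a binomial coefficient.
  dim : ℕ → ℕ → ℕ
  dim N       zero    = 1
  dim zero    (suc a) = 0
  dim (suc N) (suc a) = dim N (suc a) ℕ.+ dim N a

  nC0≡1 : ∀ n → n C 0 ≡ 1
  nC0≡1 n = trans (nCk≡nC[n∸k] {0} {n} z≤n) (nCn≡1 n)

  dim≡C : ∀ N a → dim N a ≡ N C a
  dim≡C N       zero    = sym (nC0≡1 N)
  dim≡C zero    (suc a) = refl
  dim≡C (suc N) (suc a) = trans (cong₂ ℕ._+_ (dim≡C N (suc a)) (dim≡C N a))
    (trans (ℕₚ.+-comm (N C suc a) (N C a)) (nCk+nC[k+1]≡[n+1]C[k+1] N a))

  take-++ : ∀ {A : Set} m {n} (xs : Vec A m) (ys : Vec A n) → take m (xs ++ ys) ≡ xs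
  take-++ zero    []       ys = refl
  take-++ (suc m) (x ∷ xs) ys = cong (x ∷_) (take-++ m xs ys)

  drop-++ : ∀ {A : Set} m {n} (xs : Vec A m) (ys : Vec A n) → drop m (xs ++ ys) ≡ ys
  drop-++ zero    []       ys = refl
  drop-++ (suc m) (x ∷ xs) ys = drop-++ m xs ys

  flatten : ∀ {N a} → Λ N a → Vec ℤ (dim N a)
  flatten {N} (scalar x) = x ∷ []
  flatten none           = []
  flatten (x ⊕ y)        = flatten x ++ flatten y

  unflatten : ∀ N a → Vec ℤ (dim N a) → Λ N a
  unflatten N       zero    (x ∷ []) = scalar x
  unflatten zero    (suc a) []       = none
  unflatten (suc N) (suc a) v        =
    unflatten N (suc a) (take (dim N (suc a)) v) ⊕ unflatten N a (drop (dim N (suc a)) v)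

  unflatten-flatten : ∀ {N a} (x : Λ N a) → unflatten N a (flatten x) ≡ x
  unflatten-flatten (scalar x) = refl
  unflatten-flatten none       = refl
  unflatten-flatten (_⊕_ {N} {a} x y) = cong₂ _⊕_
    (trans (cong (unflatten N (suc a)) (take-++ (dim N (suc a)) (flatten x) (flatten y))) (unflatten-flatten x))
    (trans (cong (unflatten N a) (drop-++ (dim N (suc a)) (flatten x) (flatten y))) (unflatten-flatten y))

  unflatten-lincomb : ∀ N a p q (v w : Vec ℤ (dim N a)) →
    unflatten N a (lincomb p v q w) ≡ comb p (unflatten N a v) q (unflatten N a w)
  unflatten-lincomb N       zero    p q (x ∷ []) (y ∷ []) = refl
  unflatten-lincomb zero    (suc a) p q []       []       = refl
  unflatten-lincomb (suc N) (suc a) p q v        w        = cong₂ _⊕_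
    (trans (cong (unflatten N (suc a)) (Vecₚ.take-zipWith {m = dim N (suc a)} _ v w)) (unflatten-lincomb N (suc a) p q _ _))
    (trans (cong (unflatten N a) (Vecₚ.drop-zipWith {m = dim N (suc a)} _ v w)) (unflatten-lincomb N a p q _ _))

  wedgeFunctional : ∀ {a b} → Vec Seq a → Functional (dim (a ℕ.+ b) b)
  wedgeFunctional {a} {b} vs = record
    { eval   = λ x → det (wedgeOn vs (unflatten (a ℕ.+ b) b x))
    ; linear = λ p q x y → trans (cong (det ∘ wedgeOn vs) (unflatten-lincomb (a ℕ.+ b) b p q x y))
        (trans (cong det (wedgeOn-comb vs p q (unflatten (a ℕ.+ b) b x) (unflatten (a ℕ.+ b) b y)))
               (det-comb p q (wedgeOn vs (unflatten (a ℕ.+ b) b x)) (wedgeOn vs (unflatten (a ℕ.+ b) b y))))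
    }

-- Cardinalities and exchanges in finite sets.

module SubsetCardinality where

  open import Data.Nat hiding (∣_-_∣)
  open import Data.Nat.Properties
  open import Data.Fin using (Fin; zero; suc)
  open import Data.Fin.Subset
  open import Data.Fin.Subset.Properties
  open import Data.Product using (∃; _×_; _,_; proj₂)
  open import Data.Sum using (_⊎_; inj₁; inj₂)
  open import Data.Vec using ([]; _∷_; here; there)
  open import Function using (_∘_)
  open import Relation.Nullary using (yes; no; contradiction)
  open import Relation.Binary.PropositionalEquality

  private variable
    n : ℕ

  ∣p∩q∣+∣p─q∣≡∣p∣ : (p q : Subset n) → ∣ p ∩ q ∣ + ∣ p ─ q ∣ ≡ ∣ p ∣
  ∣p∩q∣+∣p─q∣≡∣p∣ []            []            = refl
  ∣p∩q∣+∣p─q∣≡∣p∣ (outside ∷ p) (outside ∷ q) = ∣p∩q∣+∣p─q∣≡∣p∣ p q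
  ∣p∩q∣+∣p─q∣≡∣p∣ (outside ∷ p) (inside  ∷ q) = ∣p∩q∣+∣p─q∣≡∣p∣ p q
  ∣p∩q∣+∣p─q∣≡∣p∣ (inside  ∷ p) (outside ∷ q) = trans (+-suc _ _) (cong suc (∣p∩q∣+∣p─q∣≡∣p∣ p q))
  ∣p∩q∣+∣p─q∣≡∣p∣ (inside  ∷ p) (inside  ∷ q) = cong suc (∣p∩q∣+∣p─q∣≡∣p∣ p q)

  ∣p∪q∣+∣p∩q∣≡∣p∣+∣q∣ : (p q : Subset n) → ∣ p ∪ q ∣ + ∣ p ∩ q ∣ ≡ ∣ p ∣ + ∣ q ∣
  ∣p∪q∣+∣p∩q∣≡∣p∣+∣q∣ []            []            = refl
  ∣p∪q∣+∣p∩q∣≡∣p∣+∣q∣ (outside ∷ p) (outside ∷ q) = ∣p∪q∣+∣p∩q∣≡∣p∣+∣q∣ p q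
  ∣p∪q∣+∣p∩q∣≡∣p∣+∣q∣ (outside ∷ p) (inside  ∷ q) =
    trans (cong suc (∣p∪q∣+∣p∩q∣≡∣p∣+∣q∣ p q)) (sym (+-suc _ _))
  ∣p∪q∣+∣p∩q∣≡∣p∣+∣q∣ (inside  ∷ p) (outside ∷ q) = cong suc (∣p∪q∣+∣p∩q∣≡∣p∣+∣q∣ p q)
  ∣p∪q∣+∣p∩q∣≡∣p∣+∣q∣ (inside  ∷ p) (inside  ∷ q) =
    cong suc (trans (+-suc _ _) (trans (cong suc (∣p∪q∣+∣p∩q∣≡∣p∣+∣q∣ p q)) (sym (+-suc _ _))))

  choose : (p : Subset n) (m : ℕ) → m ≤ ∣ p ∣ → ∃ λ q → q ⊆ p × ∣ q ∣ ≡ m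
  choose {n} p         zero    _       = ⊥ , ⊥⊆ , ∣⊥∣≡0 n
  choose (outside ∷ p) (suc m) m<      = let q , q⊆p , eq = choose p (suc m) m< in outside ∷ q , out⊆ q⊆p , eq
  choose (inside  ∷ p) (suc m) (s≤s m≤) = let q , q⊆p , eq = choose p m m≤ in inside ∷ q , in⊆in q⊆p , cong suc eq

  x∈p─q⁻ : ∀ {x} (p q : Subset n) → x ∈ p ─ q → x ∈ p × x ∉ q
  x∈p─q⁻ (inside ∷ p) (outside ∷ q) here       = here , λ ()
  x∈p─q⁻ {x = zero} (outside ∷ p) (inside ∷ q) ()
  x∈p─q⁻ {x = zero} (outside ∷ p) (outside ∷ q) ()
  x∈p─q⁻ {x = suc _} (_ ∷ p)      (_ ∷ q)       (there x∈) =
    let x∈p , x∉q = x∈p─q⁻ p q x∈ in there x∈p , x∉q ∘ drop-there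

  p⊆q⇒p∩q≡p : {p q : Subset n} → p ⊆ q → p ∩ q ≡ p
  p⊆q⇒p∩q≡p {p = p} {q} p⊆q = ⊆-antisym (p∩q⊆p p q) λ x∈p → x∈p∩q⁺ (x∈p , p⊆q x∈p)

  Disjoint : Subset n → Subset n → Set
  Disjoint p q = ∀ {x} → x ∈ p → x ∉ q

  disjoint⇒∣p∩q∣≡0 : (p q : Subset n) → Disjoint p q → ∣ p ∩ q ∣ ≡ 0
  disjoint⇒∣p∩q∣≡0 {n} p q dis = trans (cong ∣_∣ (Empty-unique λ (x , x∈) →
    let x∈p , x∈q = x∈p∩q⁻ p q x∈ in dis x∈p x∈q)) (∣⊥∣≡0 n)

  disjoint⇒∣p∪q∣≡∣p∣+∣q∣ : (p q : Subset n) → Disjoint p q → ∣ p ∪ q ∣ ≡ ∣ p ∣ + ∣ q ∣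
  disjoint⇒∣p∪q∣≡∣p∣+∣q∣ p q dis = begin
    ∣ p ∪ q ∣               ≡⟨ +-identityʳ _ ⟨
    ∣ p ∪ q ∣ + 0           ≡⟨ cong (∣ p ∪ q ∣ +_) (disjoint⇒∣p∩q∣≡0 p q dis) ⟨
    ∣ p ∪ q ∣ + ∣ p ∩ q ∣   ≡⟨ ∣p∪q∣+∣p∩q∣≡∣p∣+∣q∣ p q ⟩
    ∣ p ∣ + ∣ q ∣ ∎
    where open ≡-Reasoning

  q⊆p⇒∣q∣+∣p─q∣≡∣p∣ : {p q : Subset n} → q ⊆ p → ∣ q ∣ + ∣ p ─ q ∣ ≡ ∣ p ∣
  q⊆p⇒∣q∣+∣p─q∣≡∣p∣ {p = p} {q} q⊆p = trans
    (cong (λ r → ∣ r ∣ + ∣ p ─ q ∣) (sym (trans (∩-comm p q) (p⊆q⇒p∩q≡p q⊆p)))) (∣p∩q∣+∣p─q∣≡∣p∣ p q)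

  0<∣p∣⇒nonempty : (p : Subset n) → 0 < ∣ p ∣ → Nonempty p
  0<∣p∣⇒nonempty {n} p 0<p with nonempty? p
  ... | yes ne = ne
  ... | no  em = contradiction (subst (0 <_) (trans (cong ∣_∣ (Empty-unique em)) (∣⊥∣≡0 n)) 0<p) λ ()

  p⊆q∧∣q∣≤∣p∣⇒q⊆p : {p q : Subset n} → p ⊆ q → ∣ q ∣ ≤ ∣ p ∣ → q ⊆ p
  p⊆q∧∣q∣≤∣p∣⇒q⊆p {p = p} p⊆q q≤p {x} x∈q with x ∈? p
  ... | yes x∈p = x∈p
  ... | no  x∉p = contradiction q≤p (<⇒≱ (p⊂q⇒∣p∣<∣q∣ (p⊆q , x , x∈q , x∉p)))

  ∣p∣≤1+∣p-x∣ : (p : Subset n) (x : Fin n) → ∣ p ∣ ≤ suc ∣ p - x ∣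
  ∣p∣≤1+∣p-x∣ p x = ≤-trans (≤-reflexive (sym (∣p∩q∣+∣p─q∣≡∣p∣ p ⁅ x ⁆)))
    (+-monoˡ-≤ ∣ p - x ∣ (≤-trans (∣p∩q∣≤∣q∣ p ⁅ x ⁆) (≤-reflexive (∣⁅x⁆∣≡1 x))))

  x∈p-y⁻ : ∀ {x y} (p : Subset n) → x ∈ p - y → x ∈ p × x ≢ y
  x∈p-y⁻ {y = y} p x∈ = let x∈p , x∉y = x∈p─q⁻ p ⁅ y ⁆ x∈ in x∈p , x∉⁅y⁆⇒x≢y x∉y

  ⁅x⁆⊆p : ∀ {x} {p : Subset n} → x ∈ p → ⁅ x ⁆ ⊆ p
  ⁅x⁆⊆p {x = x} x∈p y∈ = subst (_∈ _) (sym (x∈⁅y⁆⇒x≡y x y∈)) x∈p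

  ∪-lub : {p q r : Subset n} → p ⊆ r → q ⊆ r → p ∪ q ⊆ r
  ∪-lub {p = p} {q} p⊆r q⊆r x∈ with x∈p∪q⁻ p q x∈
  ... | inj₁ x∈p = p⊆r x∈p
  ... | inj₂ x∈q = q⊆r x∈q

  choose-between : (L U : Subset n) (m : ℕ) → L ⊆ U → ∣ L ∣ ≤ m → m ≤ ∣ U ∣ → ∃ λ q → L ⊆ q × q ⊆ U × ∣ q ∣ ≡ m
  choose-between L U m L⊆U L≤m m≤U =
    let q , q⊆ , ∣q∣≡ = choose (U ─ L) (m ∸ ∣ L ∣)
          (m≤n+o⇒m∸n≤o m ∣ L ∣ (≤-trans m≤U (≤-reflexive (sym (q⊆p⇒∣q∣+∣p─q∣≡∣p∣ L⊆U)))))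
    in L ∪ q , p⊆p∪q q , ∪-lub L⊆U (λ x∈q → p─q⊆p U L (q⊆ x∈q))
     , trans (disjoint⇒∣p∪q∣≡∣p∣+∣q∣ L q λ x∈L x∈q → proj₂ (x∈p─q⁻ U L (q⊆ x∈q)) x∈L)
             (trans (cong (∣ L ∣ +_) ∣q∣≡) (m+[n∸m]≡n L≤m))

  ⊆∧∣≡∣⇒≡ : {p q : Subset n} → p ⊆ q → ∣ p ∣ ≡ ∣ q ∣ → p ≡ q
  ⊆∧∣≡∣⇒≡ p⊆q eq = ⊆-antisym p⊆q (p⊆q∧∣q∣≤∣p∣⇒q⊆p p⊆q (≤-reflexive (sym eq)))

  ∣p∣≡∣q∣⇒∣p─q∣≡∣q─p∣ : (p q : Subset n) → ∣ p ∣ ≡ ∣ q ∣ → ∣ p ─ q ∣ ≡ ∣ q ─ p ∣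
  ∣p∣≡∣q∣⇒∣p─q∣≡∣q─p∣ p q eq = +-cancelˡ-≡ ∣ p ∩ q ∣ _ _ (trans (∣p∩q∣+∣p─q∣≡∣p∣ p q)
    (trans eq (trans (sym (∣p∩q∣+∣p─q∣≡∣p∣ q p)) (cong (λ r → ∣ r ∣ + ∣ q ─ p ∣) (∩-comm q p)))))

  swap : Subset n → Fin n → Fin n → Subset n
  swap u a b = (u - a) ∪ ⁅ b ⁆

  module _ (u : Subset n) {a b : Fin n} (a∈u : a ∈ u) (b∉u : b ∉ u) where

    ∣u∣≡1+∣u-a∣ : ∣ u ∣ ≡ suc ∣ u - a ∣
    ∣u∣≡1+∣u-a∣ = sym (trans (cong (_+ ∣ u - a ∣) (sym (∣⁅x⁆∣≡1 a))) (q⊆p⇒∣q∣+∣p─q∣≡∣p∣ (⁅x⁆⊆p a∈u)))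

    ∣swap∣ : ∣ swap u a b ∣ ≡ ∣ u ∣
    ∣swap∣ = begin
      ∣ swap u a b ∣         ≡⟨ disjoint⇒∣p∪q∣≡∣p∣+∣q∣ (u - a) ⁅ b ⁆ (λ x∈ x∈b →
                                 b∉u (subst (_∈ u) (x∈⁅y⁆⇒x≡y b x∈b) (p─q⊆p u ⁅ a ⁆ x∈))) ⟩
      ∣ u - a ∣ + ∣ ⁅ b ⁆ ∣  ≡⟨ cong (∣ u - a ∣ +_) (∣⁅x⁆∣≡1 b) ⟩
      ∣ u - a ∣ + 1          ≡⟨ +-comm ∣ u - a ∣ 1 ⟩
      suc ∣ u - a ∣          ≡⟨ ∣u∣≡1+∣u-a∣ ⟨
      ∣ u ∣ ∎
      where open ≡-Reasoning

    ∣u∣≤1+∣u∩swap∣ : ∣ u ∣ ≤ suc ∣ u ∩ swap u a b ∣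
    ∣u∣≤1+∣u∩swap∣ = ≤-trans (≤-reflexive ∣u∣≡1+∣u-a∣) (s≤s (p⊆q⇒∣p∣≤∣q∣ λ x∈ →
      x∈p∩q⁺ (p─q⊆p u ⁅ a ⁆ x∈ , p⊆p∪q ⁅ b ⁆ x∈)))

  ∈-swap⁺ : ∀ {x} (u : Subset n) {a b} → x ∈ u → x ≢ a → x ∈ swap u a b
  ∈-swap⁺ u x∈u x≢a = p⊆p∪q _ (x∈p∧x≢y⇒x∈p-y x∈u x≢a)

  b∈swap : ∀ (u : Subset n) a b → b ∈ swap u a b
  b∈swap u a b = q⊆p∪q (u - a) ⁅ b ⁆ (x∈⁅x⁆ b)

  ∈-swap⁻ : ∀ {x} (u : Subset n) {a b} → x ∈ swap u a b → (x ∈ u × x ≢ a) ⊎ x ≡ b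
  ∈-swap⁻ u {a} {b} x∈ with x∈p∪q⁻ (u - a) ⁅ b ⁆ x∈
  ... | inj₁ x∈u-a = inj₁ (x∈p-y⁻ u x∈u-a)
  ... | inj₂ x∈b   = inj₂ (x∈⁅y⁆⇒x≡y b x∈b)

-- Generic points, subresultants and the skew Bollobás inequality.

module SkewBollobás where

  open import Data.Nat as ℕ using (ℕ; zero; suc; s≤s; z<s)
  import Data.Nat.Properties as ℕₚ
  open import Data.Nat.Combinatorics using (_C_)
  open import Data.Integer using (ℤ; 0ℤ; 1ℤ; -1ℤ; +_; _+_; _*_; -_; _-_; _≟_; ∣_∣)
  import Data.Integer.Properties as ℤₚ
  open import Data.Integer.Tactic.RingSolver using (solve-∀)
  open import Data.Fin.Subset as Sub using (Subset; inside; outside; _∩_; _∪_; _─_)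
  import Data.Fin.Subset.Properties as Subₚ
  open import Data.List as List using (List; []; _∷_; length)
  import Data.List.Properties as Listₚ
  open import Data.List.Relation.Unary.All as All using (All; []; _∷_)
  import Data.List.Relation.Unary.All.Properties as Allₚ
  open import Data.List.Relation.Unary.AllPairs as AllPairs using (AllPairs; []; _∷_)
  import Data.List.Relation.Unary.AllPairs.Properties as AllPairsₚ
  open import Data.Product using (∃; _×_; _,_; proj₁; proj₂)
  open import Data.Sum using (_⊎_; inj₁; inj₂)
  open import Data.Vec as Vec using (Vec; []; _∷_; zipWith; _++_)
  import Data.Vec.Relation.Unary.Any as Any
  open import Data.Vec.Membership.Propositional using (_∈_)
  open import Function using (_∘_)
  open import Relation.Nullary using (yes; no; contradiction)
  open import Relation.Binary.PropositionalEquality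
  open ExteriorPower
  open TriangularSystem
  open SubsetCardinality

  horner : List ℤ → ℕ → ℤ
  horner []       s = 0ℤ
  horner (c ∷ cs) s = c + + s * horner cs s

  -- The coefficients are explicit data, so that vanishing identically becomes decidable.
  IsPoly : (ℕ → ℤ) → Set
  IsPoly f = ∃ λ cs → horner cs ≗ f

  poly-const : ∀ c → IsPoly (λ _ → c)
  poly-const c = c ∷ [] , λ s → trans (cong (λ z → c + z) (ℤₚ.*-zeroʳ (+ s))) (ℤₚ.+-identityʳ c)

  poly-+ : ∀ {f g} → IsPoly f → IsPoly g → IsPoly (λ s → f s + g s)
  poly-+ (as , p) (bs , q) = add as bs , λ s → trans (horner-add as bs s) (cong₂ _+_ (p s) (q s))
    where
    add : List ℤ → List ℤ → List ℤ
    add []       bs       = bs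
    add (a ∷ as) []       = a ∷ as
    add (a ∷ as) (b ∷ bs) = (a + b) ∷ add as bs
    horner-add : ∀ as bs s → horner (add as bs) s ≡ horner as s + horner bs s
    horner-add []       bs       s = sym (ℤₚ.+-identityˡ _)
    horner-add (a ∷ as) []       s = sym (ℤₚ.+-identityʳ _)
    horner-add (a ∷ as) (b ∷ bs) s = trans (cong (λ z → a + b + + s * z) (horner-add as bs s))
      (identity a b (+ s) (horner as s) (horner bs s))
      where
      identity : ∀ a b s x y → a + b + s * (x + y) ≡ (a + s * x) + (b + s * y)
      identity = solve-∀

  poly-scale : ∀ c {f} → IsPoly f → IsPoly (λ s → c * f s)
  poly-scale c (as , p) = List.map (c *_) as , λ s → trans (horner-scale as s) (cong (c *_) (p s))
    where
    horner-scale : ∀ as s → horner (List.map (c *_) as) s ≡ c * horner as s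
    horner-scale []       s = sym (ℤₚ.*-zeroʳ c)
    horner-scale (a ∷ as) s = trans (cong (λ z → c * a + + s * z) (horner-scale as s)) (identity c a (+ s) (horner as s))
      where
      identity : ∀ c a s x → c * a + s * (c * x) ≡ c * (a + s * x)
      identity = solve-∀

  poly-shift : ∀ {f} → IsPoly f → IsPoly (λ s → + s * f s)
  poly-shift (as , p) = 0ℤ ∷ as , λ s → trans (ℤₚ.+-identityˡ _) (cong (+ s *_) (p s))

  poly-resp : ∀ {f g} → f ≗ g → IsPoly f → IsPoly g
  poly-resp eq (as , p) = as , λ s → trans (p s) (eq s)

  poly-* : ∀ {f g} → IsPoly f → IsPoly g → IsPoly (λ s → f s * g s)
  poly-* {f} {g} (as , p) pg = poly-resp (λ s → cong (_* g s) (p s)) (mul as)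
    where
    mul : ∀ as → IsPoly (λ s → horner as s * g s)
    mul []       = poly-const 0ℤ
    mul (a ∷ as) = poly-resp (λ s → identity a (+ s) (horner as s) (g s)) (poly-+ (poly-scale a pg) (poly-shift (mul as)))
      where
      identity : ∀ a s x y → a * y + s * (x * y) ≡ (a + s * x) * y
      identity = solve-∀

  large-multiple : ∀ c e s → e ≢ 0ℤ → ∣ c ∣ ℕ.< s → c + + s * e ≢ 0ℤ
  large-multiple c e s e≢0 ∣c∣<s eq = ℕₚ.<-irrefl refl (begin-strict
    ∣ c ∣              <⟨ ∣c∣<s ⟩
    s                  ≤⟨ ℕₚ.m≤m*n s ∣ e ∣ {{ℕ.≢-nonZero (e≢0 ∘ ℤₚ.∣i∣≡0⇒i≡0)}} ⟩
    s ℕ.* ∣ e ∣        ≡⟨ ℤₚ.abs-* (+ s) e ⟨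
    ∣ + s * e ∣        ≡⟨ ℤₚ.∣-i∣≡∣i∣ (+ s * e) ⟨
    ∣ - (+ s * e) ∣    ≡⟨ cong ∣_∣ (ℤₚ.i-j≡0⇒i≡j c (- (+ s * e)) (trans (cong (λ z → c + z) (ℤₚ.neg-involutive _)) eq)) ⟨
    ∣ c ∣ ∎)
    where open ℕₚ.≤-Reasoning

  -- Integrality replaces a count of roots. If `horner cs` is eventually nonzero, its absolute value
  -- is then at least 1, so s times it cannot cancel c once s > |c|. If it vanishes identically,
  -- only the constant c is left.
  horner-dichotomy : ∀ cs → (∀ s → horner cs s ≡ 0ℤ) ⊎ ∃ λ M → ∀ s → M ℕ.≤ s → horner cs s ≢ 0ℤ
  horner-dichotomy [] = inj₁ λ _ → refl
  horner-dichotomy (c ∷ cs) with horner-dichotomy cs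
  ... | inj₂ (M , large) = inj₂ (M ℕ.⊔ suc ∣ c ∣ , λ s M≤s →
    large-multiple c (horner cs s) s (large s (ℕₚ.m⊔n≤o⇒m≤o M _ M≤s)) (ℕₚ.m⊔n≤o⇒n≤o M _ M≤s))
  ... | inj₁ vanishes with c ≟ 0ℤ
  ... | yes refl = inj₁ λ s → trans (ℤₚ.+-identityˡ _) (trans (cong (+ s *_) (vanishes s)) (ℤₚ.*-zeroʳ (+ s)))
  ... | no c≢0 = inj₂ (0 , λ s _ eq → c≢0 (trans (sym (ℤₚ.+-identityʳ c))
    (trans (sym (cong (λ z → c + z) (trans (cong (+ s *_) (vanishes s)) (ℤₚ.*-zeroʳ (+ s))))) eq)))

  poly-eventually≢0 : ∀ {f} → IsPoly f → ∀ s → f s ≢ 0ℤ → ∃ λ M → ∀ r → M ℕ.≤ r → f r ≢ 0ℤ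
  poly-eventually≢0 (cs , p) s fs≢0 with horner-dichotomy cs
  ... | inj₁ vanishes    = contradiction (trans (sym (p s)) (vanishes s)) fs≢0
  ... | inj₂ (M , large) = M , λ r M≤r eq → large r M≤r (trans (p r) eq)

  line : ∀ {n} → Vec ℤ n → Vec ℤ n → ℕ → Vec ℤ n
  line x y s = zipWith (λ a b → a + + s * (b - a)) x y

  line-0 : ∀ {n} (x y : Vec ℤ n) → line x y 0 ≡ x
  line-0 []      []      = refl
  line-0 (a ∷ x) (b ∷ y) = cong₂ _∷_ (ℤₚ.+-identityʳ a) (line-0 x y)

  line-1 : ∀ {n} (x y : Vec ℤ n) → line x y 1 ≡ y
  line-1 []      []      = refl
  line-1 (a ∷ x) (b ∷ y) = cong₂ _∷_ (identity a b) (line-1 x y)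
    where
    identity : ∀ a b → a + 1ℤ * (b - a) ≡ b
    identity = solve-∀

  PolyOnLines : ∀ {n} → (Vec ℤ n → ℤ) → Set
  PolyOnLines F = ∀ x y → IsPoly (λ s → F (line x y s))

  -- Join a common nonzero of the tail to a nonzero of the head by a line: far out on it nothing vanishes.
  common-nonzero : ∀ {n} (Fs : List (Vec ℤ n → ℤ)) → All PolyOnLines Fs →
    All (λ F → ∃ λ y → F y ≢ 0ℤ) Fs → ∃ λ y → All (λ F → F y ≢ 0ℤ) Fs
  common-nonzero []       _        _                = Vec.replicate _ 0ℤ , []
  common-nonzero (F ∷ Fs) (p ∷ ps) ((y , Fy) ∷ nzs) =
    let x , Fsx     = common-nonzero Fs ps nzs
        M , F-large = poly-eventually≢0 (p x y) 1 (subst (λ z → F z ≢ 0ℤ) (sym (line-1 x y)) Fy)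
        s , M≤s , Fs-nz = large x M Fs ps Fsx
    in line x y s , F-large s M≤s ∷ Fs-nz s ℕₚ.≤-refl
    where
    large : ∀ x M Gs → All PolyOnLines Gs → All (λ G → G x ≢ 0ℤ) Gs →
      ∃ λ s → M ℕ.≤ s × (∀ r → s ℕ.≤ r → All (λ G → G (line x y r) ≢ 0ℤ) Gs)
    large x M []       _        _          = M , ℕₚ.≤-refl , λ _ _ → []
    large x M (G ∷ Gs) (p ∷ ps) (Gx ∷ Gsx) =
      let s , M≤s , h = large x M Gs ps Gsx
          K , G-large = poly-eventually≢0 (p x y) 0 (subst (λ z → G z ≢ 0ℤ) (sym (line-0 x y)) Gx)
      in K ℕ.⊔ s , ℕₚ.≤-trans M≤s (ℕₚ.m≤n⊔m K s) , λ r le →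
           G-large r (ℕₚ.m⊔n≤o⇒m≤o K s le) ∷ h r (ℕₚ.m⊔n≤o⇒n≤o K s le)

  -- Sequences are read as coefficients of power series in z, and this is multiplication by z.
  Z : Seq → Seq
  Z p zero    = 0ℤ
  Z p (suc i) = p i

  one : Seq
  one zero    = 1ℤ
  one (suc i) = 0ℤ

  -- Multiplication by 1 − c z.
  factor : ℤ → Seq → Seq
  factor c p i = 1ℤ * p i + (- c) * Z p i

  prod : ∀ {n} → Vec ℤ n → Subset n → Seq → Seq
  prod []      []            p = p
  prod (c ∷ y) (inside  ∷ A) p = factor c (prod y A p)
  prod (c ∷ y) (outside ∷ A) p = prod y A p

  Z-cong : ∀ {p q} → p ≗ q → Z p ≗ Z q
  Z-cong eq zero    = refl
  Z-cong eq (suc i) = eq i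

  factor-cong : ∀ c {p q} → p ≗ q → factor c p ≗ factor c q
  factor-cong c eq i = cong₂ (λ a b → 1ℤ * a + (- c) * b) (eq i) (Z-cong eq i)

  factor-Z : ∀ c p → factor c (Z p) ≗ Z (factor c p)
  factor-Z c p zero    = identity c
    where
    identity : ∀ c → 1ℤ * 0ℤ + (- c) * 0ℤ ≡ 0ℤ
    identity = solve-∀
  factor-Z c p (suc i) = refl

  factor-comm : ∀ c d p → factor c (factor d p) ≗ factor d (factor c p)
  factor-comm c d p i = trans (cong (λ z → 1ℤ * (1ℤ * p i + (- d) * Z p i) + (- c) * z) (sym (factor-Z d p i)))
    (trans (identity c d (p i) (Z p i) (Z (Z p) i))
           (cong (λ z → 1ℤ * (1ℤ * p i + (- c) * Z p i) + (- d) * z) (factor-Z c p i)))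
    where
    identity : ∀ c d x y z → 1ℤ * (1ℤ * x + (- d) * y) + (- c) * (1ℤ * y + (- d) * z)
                           ≡ 1ℤ * (1ℤ * x + (- c) * y) + (- d) * (1ℤ * y + (- c) * z)
    identity = solve-∀

  prod-factor : ∀ {n} (y : Vec ℤ n) A c p → prod y A (factor c p) ≗ factor c (prod y A p)
  prod-factor []      []            c p i = refl
  prod-factor (d ∷ y) (inside  ∷ A) c p i =
    trans (factor-cong d (prod-factor y A c p) i) (factor-comm d c (prod y A p) i)
  prod-factor (d ∷ y) (outside ∷ A) c p i = prod-factor y A c p i

  prod-∪ : ∀ {n} (y : Vec ℤ n) A B p → prod y (B ─ A) (prod y A p) ≗ prod y (B ∪ A) p
  prod-∪ []      []            []            p i = refl
  prod-∪ (c ∷ y) (inside  ∷ A) (inside  ∷ B) p i =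
    trans (prod-factor y (B ─ A) c (prod y A p) i) (factor-cong c (prod-∪ y A B p) i)
  prod-∪ (c ∷ y) (inside  ∷ A) (outside ∷ B) p i =
    trans (prod-factor y (B ─ A) c (prod y A p) i) (factor-cong c (prod-∪ y A B p) i)
  prod-∪ (c ∷ y) (outside ∷ A) (inside  ∷ B) p i = factor-cong c (prod-∪ y A B p) i
  prod-∪ (c ∷ y) (outside ∷ A) (outside ∷ B) p i = prod-∪ y A B p i

  poly : ∀ {n} → Vec ℤ n → Subset n → Seq
  poly y A = prod y A one

  -- Both sides are p_{A ∪ B}. This is the dependence between shifts of p_A and shifts of p_B that
  -- makes the pairing vanish; its cofactors have degrees at most |B ∖ A| and |A ∖ B|.
  prod-swap : ∀ {n} (y : Vec ℤ n) A B → prod y (B ─ A) (poly y A) ≗ prod y (A ─ B) (poly y B)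
  prod-swap y A B i = trans (prod-∪ y A B one i)
    (trans (cong (λ U → prod y U one i) (Subₚ.∪-comm B A)) (sym (prod-∪ y B A one i)))

  Z^ : ℕ → Seq → Seq
  Z^ zero    p = p
  Z^ (suc j) p = Z^ j (Z p)

  Z^-cong : ∀ j {p q} → p ≗ q → Z^ j p ≗ Z^ j q
  Z^-cong zero    eq = eq
  Z^-cong (suc j) eq = Z^-cong j (Z-cong eq)

  Z^-factor : ∀ j c p → Z^ j (factor c p) ≗ factor c (Z^ j p)
  Z^-factor zero    c p i = refl
  Z^-factor (suc j) c p i = trans (Z^-cong j (λ i → sym (factor-Z c p i)) i) (Z^-factor j c (Z p) i)

  Z-Z^ : ∀ j p → Z (Z^ j p) ≗ Z^ (suc j) p
  Z-Z^ zero    p i = refl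
  Z-Z^ (suc j) p i = Z-Z^ j (Z p) i

  module _ {P : Seq → Set} (sub : IsSubspace P) where
    open IsSubspace sub

    -- The coefficient `1ℤ` written out in `factor` makes it literally an instance of `closed`.
    subspace-factor : ∀ c {p} → P p → P (Z p) → P (factor c p)
    subspace-factor c = closed 1ℤ (- c)

    -- Each factor 1 - c z reaches one shift further, so |S| factors involve only the shifts j, ...,
    -- j + |S| of p.
    subspace-Z^-prod : ∀ {n} (y : Vec ℤ n) S p j → (∀ i → j ℕ.≤ i → i ℕ.≤ j ℕ.+ Sub.∣ S ∣ → P (Z^ i p)) →
      P (Z^ j (prod y S p))
    subspace-Z^-prod []      []            p j h = h j ℕₚ.≤-refl (ℕₚ.m≤m+n j 0)
    subspace-Z^-prod (c ∷ y) (outside ∷ S) p j h = subspace-Z^-prod y S p j h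
    subspace-Z^-prod (c ∷ y) (inside  ∷ S) p j h = respects (λ i → sym (Z^-factor j c (prod y S p) i))
      (subspace-factor c
        (subspace-Z^-prod y S p j λ i j≤i i≤ → h i j≤i (ℕₚ.≤-trans i≤ (ℕₚ.+-monoʳ-≤ j (ℕₚ.n≤1+n _))))
        (respects (λ i → sym (Z-Z^ j (prod y S p) i))
          (subspace-Z^-prod y S p (suc j) λ i j<i i≤ →
            h i (ℕₚ.<⇒≤ j<i) (ℕₚ.≤-trans i≤ (ℕₚ.≤-reflexive (sym (ℕₚ.+-suc j _)))))))

    -- The constant term of a product of factors is 1, so p is recovered modulo the Zⁱ p with i ≥ 1.
    subspace-prod⁻ : ∀ {n} (y : Vec ℤ n) S p → (∀ i → 1 ℕ.≤ i → i ℕ.≤ Sub.∣ S ∣ → P (Z^ i p)) →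
      P (prod y S p) → P p
    subspace-prod⁻ []      []            p h Pp = Pp
    subspace-prod⁻ (c ∷ y) (outside ∷ S) p h Pp = subspace-prod⁻ y S p h Pp
    subspace-prod⁻ (c ∷ y) (inside  ∷ S) p h Pp =
      subspace-prod⁻ y S p (λ i 1≤i i≤ → h i 1≤i (ℕₚ.m≤n⇒m≤1+n i≤))
        (respects (λ i → identity c (prod y S p i) (Z (prod y S p) i))
          (closed 1ℤ c Pp (subspace-Z^-prod y S p 1 h)))
      where
      identity : ∀ c x y → 1ℤ * (1ℤ * x + (- c) * y) + c * y ≡ x
      identity = solve-∀

  rows : ∀ d → Seq → Vec Seq d
  rows zero    p = []
  rows (suc d) p = p ∷ rows d (Z p)

  ∈-rows : ∀ {j d} p → j ℕ.< d → Z^ j p ∈ rows d p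
  ∈-rows {zero}  {suc d} p _         = Any.here refl
  ∈-rows {suc j} {suc d} p (s≤s j<d) = Any.there (∈-rows (Z p) j<d)

  -- A subresultant of the polynomials with reciprocal roots y on A and on B.
  pairing : ∀ {n} → ℕ → Subset n → Subset n → Vec ℤ n → ℤ
  pairing d A B y = det (wedgeOn {N = d ℕ.+ d} (rows d (poly y A)) (wedge (rows d (poly y B))))

  -- The product p_{B∖A} p_A = p_{A∖B} p_B is a combination of the rows zⁱ p_B. As p_{B∖A} has
  -- constant term 1, removing the rows zⁱ p_A with i ≥ 1 leaves p_A itself, so the first row
  -- depends on the others. The strict bounds keep every shift used among the available rows.
  pairing≡0 : ∀ {n} d (A B : Subset n) y → Sub.∣ A ─ B ∣ ℕ.< d → Sub.∣ B ─ A ∣ ℕ.< d → pairing d A B y ≡ 0ℤ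
  pairing≡0 (suc d) A B y (s≤s A─B≤) (s≤s B─A≤) = trans (cong det annihilated) (det-0 {suc d ℕ.+ suc d})
    where
    pA = poly y A
    pB = poly y B
    X : Λ (suc d ℕ.+ suc d) (d ℕ.+ suc d)
    X = wedgeOn (rows d (Z pA)) (wedge (rows (suc d) pB))
    sub = annihilator-isSubspace X
    open IsSubspace sub
    ann-A : ∀ i → 1 ℕ.≤ i → i ℕ.≤ d → Annihilates X (Z^ i pA)
    ann-A (suc i) _ i<d = ∈-annihilates-wedgeOn (rows d (Z pA)) (∈-rows (Z pA) i<d)
    ann-B : ∀ i → i ℕ.≤ d → Annihilates X (Z^ i pB)
    ann-B i i≤d = annihilates-wedgeOn (rows d (Z pA)) (∈-annihilates-wedge (rows (suc d) pB) (∈-rows pB (s≤s i≤d)))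
    annihilated : Annihilates X pA
    annihilated = subspace-prod⁻ sub y (B ─ A) pA (λ i 1≤i i≤ → ann-A i 1≤i (ℕₚ.≤-trans i≤ B─A≤))
      (respects (λ i → sym (prod-swap y A B i))
        (subspace-Z^-prod sub y (A ─ B) pB 0 (λ i _ i≤ → ann-B i (ℕₚ.≤-trans i≤ A─B≤))))

  HasDegree : ℕ → Seq → Set
  HasDegree m p = p m ≢ 0ℤ × (∀ i → m ℕ.< i → p i ≡ 0ℤ)

  degree-Z : ∀ {m p} → HasDegree m p → HasDegree (suc m) (Z p)
  degree-Z (p≢0 , above) = p≢0 , λ { (suc i) (s≤s m<i) → above i m<i }

  degree-suc : ∀ {m p} → HasDegree (suc m) p → HasDegree m (p ∘ suc)
  degree-suc (p≢0 , above) = p≢0 , λ i m<i → above (suc i) (s≤s m<i)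

  -- Rows of exact degrees r, r + 1, ...; for r = 0 the coefficient matrix is triangular with
  -- nonzero diagonal.
  data Staircase : ∀ {a} → ℕ → Vec Seq a → Set where
    []  : ∀ {r} → Staircase r []
    _∷_ : ∀ {r a v} {vs : Vec Seq a} → HasDegree r v → Staircase (suc r) vs → Staircase r (v ∷ vs)

  staircase-rows : ∀ d {r p} → HasDegree r p → Staircase r (rows d p)
  staircase-rows zero    deg = []
  staircase-rows (suc d) deg = deg ∷ staircase-rows d (degree-Z deg)

  staircase-++ : ∀ {a b r} {us : Vec Seq a} {vs : Vec Seq b} →
    Staircase r us → Staircase (a ℕ.+ r) vs → Staircase r (us ++ vs)
  staircase-++ [] t = t
  staircase-++ {suc a} {r = r} {vs = vs} (deg ∷ s) t = deg ∷ staircase-++ s (subst (λ m → Staircase m vs) (sym (ℕₚ.+-suc a r)) t)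

  staircase-tails : ∀ {a r} {vs : Vec Seq a} → Staircase (suc r) vs → Staircase r (Vec.map (_∘ suc) vs)
  staircase-tails []        = []
  staircase-tails (deg ∷ s) = degree-suc deg ∷ staircase-tails s

  proj : ∀ {N a} → Λ (suc N) a → Λ N a
  proj (scalar x) = scalar x
  proj (x ⊕ y)    = x

  proj-∧ : ∀ {N a} v (x : Λ (suc N) a) → proj (v ∧ x) ≡ (v ∘ suc) ∧ proj x
  proj-∧ v (scalar x) = refl
  proj-∧ v (x ⊕ y)    = refl

  proj-wedge : ∀ {N a} (vs : Vec Seq a) → proj (wedge {N = suc N} vs) ≡ wedge (Vec.map (_∘ suc) vs)
  proj-wedge []       = refl
  proj-wedge (v ∷ vs) = trans (proj-∧ v (wedge vs)) (cong ((v ∘ suc) ∧_) (proj-wedge vs))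

  det-zero-∧ : ∀ {N} {v : Seq} → (∀ i → v i ≡ 0ℤ) → (x : Λ (suc N) N) → det (v ∧ x) ≡ 0ℤ
  det-zero-∧ {v = v} v≡0 x = begin
    det (v ∧ x)                           ≡⟨ cong det (∧-congˡ v≡0 x) ⟩
    det ((λ i → 0ℤ * v i + 0ℤ * v i) ∧ x) ≡⟨ cong det (comb-∧ 0ℤ 0ℤ v v x) ⟩
    det (comb 0ℤ (v ∧ x) 0ℤ (v ∧ x))      ≡⟨ det-comb 0ℤ 0ℤ (v ∧ x) (v ∧ x) ⟩
    0ℤ ∎
    where open ≡-Reasoning

  det-degree0-∧ : ∀ {N} {v : Seq} → (∀ i → v (suc i) ≡ 0ℤ) → (x : Λ (suc N) N) → det (v ∧ x) ≡ v 0 * det (proj x)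
  det-degree0-∧ h (scalar x) = refl
  det-degree0-∧ {v = v} h (x ⊕ y) = begin
    det (comb (v 0) x -1ℤ ((v ∘ suc) ∧ y))            ≡⟨ det-comb (v 0) -1ℤ x ((v ∘ suc) ∧ y) ⟩
    v 0 * det x + -1ℤ * det ((v ∘ suc) ∧ y)           ≡⟨ cong (λ z → v 0 * det x + -1ℤ * z) (det-zero-∧ h y) ⟩
    v 0 * det x + 0ℤ                                  ≡⟨ ℤₚ.+-identityʳ _ ⟩
    v 0 * det x ∎
    where open ≡-Reasoning

  -- Expansion along the first row: having degree 0 it is v₀ e₀, so the other rows matter only
  -- modulo e₀, where each degree falls by one.
  det-staircase : ∀ {N} {vs : Vec Seq N} → Staircase 0 vs → det (wedge {N = N} vs) ≢ 0ℤ
  det-staircase [] ()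
  det-staircase {suc N} {v ∷ vs} ((v₀≢0 , above) ∷ s) eq =
    *-≢0 v₀≢0 (det-staircase (staircase-tails s))
      (trans (cong (λ x → v 0 * det x) (sym (proj-wedge vs)))
        (trans (sym (det-degree0-∧ (λ i → above (suc i) z<s) (wedge vs))) eq))

  wedgeOn-wedge : ∀ {N a b} (us : Vec Seq a) (vs : Vec Seq b) → wedgeOn {N = N} us (wedge vs) ≡ wedge (us ++ vs)
  wedgeOn-wedge []       vs = refl
  wedgeOn-wedge (u ∷ us) vs = cong (u ∧_) (wedgeOn-wedge us vs)

  indicator : ∀ {n} → Subset n → Vec ℤ n
  indicator = Vec.map λ { inside → 1ℤ ; outside → 0ℤ }

  -- At this point p_A is (1 - z) to the power |S ∩ A|, the remaining factors being 1.
  degree-indicator : ∀ {n} (S A : Subset n) → HasDegree Sub.∣ S ∩ A ∣ (poly (indicator S) A)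
  degree-indicator []            []            = (λ ()) , λ { (suc i) _ → refl }
  degree-indicator (inside  ∷ S) (outside ∷ A) = degree-indicator S A
  degree-indicator (outside ∷ S) (outside ∷ A) = degree-indicator S A
  degree-indicator (outside ∷ S) (inside  ∷ A) =
    let p≢0 , above = degree-indicator S A
    in (λ eq → p≢0 (trans (sym (identity _ (Z p Sub.∣ S ∩ A ∣))) eq)) , λ i m<i → trans (identity _ (Z p i)) (above i m<i)
    where
    p = poly (indicator S) A
    identity : ∀ x y → 1ℤ * x + (- 0ℤ) * y ≡ x
    identity = solve-∀
  degree-indicator (inside  ∷ S) (inside  ∷ A) =
    let p≢0 , above = degree-indicator S A
    in (λ eq → p≢0 (trans (sym (ℤₚ.neg-involutive _)) (cong -_ (trans (sym (identity _ _ (above _ ℕₚ.≤-refl))) eq))))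
     , λ { (suc i) (s≤s m<i) → trans (identity (p (suc i)) (p i) (above (suc i) (ℕₚ.m≤n⇒m≤1+n m<i))) (cong -_ (above i m<i)) }
    where
    p = poly (indicator S) A
    negate : ∀ y → 1ℤ * 0ℤ + (- 1ℤ) * y ≡ - y
    negate = solve-∀
    identity : ∀ x y → x ≡ 0ℤ → 1ℤ * x + (- 1ℤ) * y ≡ - y
    identity x y refl = negate y

  -- With y = 0 on A and y = 1 on a d-subset of B ∖ A, the polynomials have degrees 0 and d.
  pairing≢0 : ∀ {n} d (A B : Subset n) → d ℕ.≤ Sub.∣ B ─ A ∣ → ∃ λ y → pairing d A B y ≢ 0ℤ
  pairing≢0 d A B d≤ =
    let S , S⊆ , ∣S∣≡d = choose (B ─ A) d d≤
        S∩A≡0 : Sub.∣ S ∩ A ∣ ≡ 0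
        S∩A≡0 = disjoint⇒∣p∩q∣≡0 S A (λ x∈S → proj₂ (x∈p─q⁻ B A (S⊆ x∈S)))
        S∩B≡d : Sub.∣ S ∩ B ∣ ≡ d ℕ.+ 0
        S∩B≡d = trans (cong Sub.∣_∣ (p⊆q⇒p∩q≡p (λ x∈S → proj₁ (x∈p─q⁻ B A (S⊆ x∈S)))))
                      (trans ∣S∣≡d (sym (ℕₚ.+-identityʳ d)))
        y = indicator S
    in y , λ eq → det-staircase
        (staircase-++ (staircase-rows d (subst (λ m → HasDegree m (poly y A)) S∩A≡0 (degree-indicator S A)))
                      (staircase-rows d (subst (λ m → HasDegree m (poly y B)) S∩B≡d (degree-indicator S B))))
        (trans (cong det (sym (wedgeOn-wedge (rows d (poly y A)) (rows d (poly y B))))) eq)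

  PolySeq : (ℕ → Seq) → Set
  PolySeq w = ∀ i → IsPoly (λ s → w s i)

  -- Coordinatewise polynomial dependence, shaped like `Λ` so that each exterior operation reduces
  -- to closure of `IsPoly` under sums and products.
  data PolyΛ : ∀ {N a} → (ℕ → Λ N a) → Set where
    scalar : ∀ {N f} → IsPoly f → PolyΛ {N} (λ s → scalar (f s))
    none   : ∀ {a} → PolyΛ {0} {suc a} (λ _ → none)
    _⊕_    : ∀ {N a} {F : ℕ → Λ N (suc a)} {G : ℕ → Λ N a} → PolyΛ F → PolyΛ G → PolyΛ (λ s → F s ⊕ G s)

  poly-comb : ∀ {N a c d} {F G : ℕ → Λ N a} → IsPoly c → PolyΛ F → IsPoly d → PolyΛ G →
    PolyΛ (λ s → comb (c s) (F s) (d s) (G s))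
  poly-comb c (scalar f) d (scalar g) = scalar (poly-+ (poly-* c f) (poly-* d g))
  poly-comb c none       d none       = none
  poly-comb c (F ⊕ G)    d (F′ ⊕ G′)  = poly-comb c F d F′ ⊕ poly-comb c G d G′

  poly-∧ : ∀ {N a w} {F : ℕ → Λ N a} → PolySeq w → PolyΛ F → PolyΛ (λ s → w s ∧ F s)
  poly-∧ {zero}  w (scalar f) = none
  poly-∧ {suc N} w (scalar f) = poly-∧ (w ∘ suc) (scalar f) ⊕ scalar (poly-* (w 0) f)
  poly-∧ w none    = none
  poly-∧ w (F ⊕ G) = poly-∧ (w ∘ suc) F ⊕ poly-comb (w 0) F (poly-const -1ℤ) (poly-∧ (w ∘ suc) G)

  poly-det : ∀ {N} {F : ℕ → Λ N N} → PolyΛ F → IsPoly (λ s → det (F s))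
  poly-det (scalar f) = f
  poly-det (F ⊕ G)    = poly-det G

  polySeq-Z : ∀ {w} → PolySeq w → PolySeq (λ s → Z (w s))
  polySeq-Z w zero    = poly-const 0ℤ
  polySeq-Z w (suc i) = w i

  poly-wedgeOn-rows : ∀ {N a} d {w} {F : ℕ → Λ N a} → PolySeq w → PolyΛ F → PolyΛ (λ s → wedgeOn (rows d (w s)) (F s))
  poly-wedgeOn-rows zero    w F = F
  poly-wedgeOn-rows (suc d) w F = poly-∧ w (poly-wedgeOn-rows d (polySeq-Z w) F)

  poly-wedge-rows : ∀ {N} d {w} → PolySeq w → PolyΛ (λ s → wedge {N = N} (rows d (w s)))
  poly-wedge-rows zero    w = scalar (poly-const 1ℤ)
  poly-wedge-rows (suc d) w = poly-∧ w (poly-wedge-rows d (polySeq-Z w))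

  polySeq-poly : ∀ {n} (x y : Vec ℤ n) A → PolySeq (λ s → poly (line x y s) A)
  polySeq-poly []      []      []            i = poly-const (one i)
  polySeq-poly (a ∷ x) (b ∷ y) (outside ∷ A) i = polySeq-poly x y A i
  polySeq-poly (a ∷ x) (b ∷ y) (inside  ∷ A) i =
    poly-+ (poly-scale 1ℤ (polySeq-poly x y A i))
           (poly-* (poly-resp (λ s → ℤₚ.-1*i≡-i _) (poly-scale -1ℤ (poly-+ (poly-const a) (poly-shift (poly-const (b - a))))))
                   (polySeq-Z (polySeq-poly x y A) i))

  pairing-polyOnLines : ∀ {n} d (A B : Subset n) → PolyOnLines (pairing d A B)
  pairing-polyOnLines d A B x y =
    poly-det (poly-wedgeOn-rows d (polySeq-poly x y A) (poly-wedge-rows d (polySeq-poly x y B)))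

  -- Differences instead of intersections keep the set sizes out: for k-sets, |A ∩ B| > k - d says
  -- exactly |A ∖ B| < d. The off-diagonal pairings vanish for every y, so y need only be generic
  -- for the finitely many diagonal ones.
  skew-bollobás : ∀ {n} d (L : List (Subset n × Subset n)) →
    All (λ (A , B) → d ℕ.≤ Sub.∣ B ─ A ∣) L →
    AllPairs (λ (A , _) (_ , B) → Sub.∣ A ─ B ∣ ℕ.< d × Sub.∣ B ─ A ∣ ℕ.< d) L →
    length L ℕ.≤ (d ℕ.+ d) C d
  skew-bollobás {n} d L diag skew = begin
    length L                      ≡⟨ Listₚ.length-map system L ⟨
    length (List.map system L)    ≤⟨ triangular⇒length≤ _ (AllPairsₚ.map⁺ (AllPairs.map (λ {p} {q} → vanish {p} {q}) skew)
                                                         , Allₚ.map⁺ (All.map (λ {p} → nonvanish {p}) (Allₚ.map⁻ y-good))) ⟩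
    dim (d ℕ.+ d) d               ≡⟨ dim≡C (d ℕ.+ d) d ⟩
    (d ℕ.+ d) C d                 ∎
    where
    open ℕₚ.≤-Reasoning
    pair : Subset n × Subset n → Vec ℤ n → ℤ
    pair (A , B) = pairing d A B
    generic : ∃ λ y → All (λ F → F y ≢ 0ℤ) (List.map pair L)
    generic = common-nonzero (List.map pair L)
      (Allₚ.map⁺ (All.universal (λ (A , B) → pairing-polyOnLines d A B) L))
      (Allₚ.map⁺ (All.map (λ {(A , B)} → pairing≢0 d A B) diag))
    y = proj₁ generic
    y-good = proj₂ generic
    system : Subset n × Subset n → Functional (dim (d ℕ.+ d) d) × Vec ℤ (dim (d ℕ.+ d) d)
    system (A , B) = wedgeFunctional {d} {d} (rows d (poly y A)) , flatten (wedge (rows d (poly y B)))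
    eval-system : ∀ A B → Functional.eval (proj₁ (system (A , B))) (flatten (wedge (rows d (poly y B)))) ≡ pairing d A B y
    eval-system A B = cong (det ∘ wedgeOn (rows d (poly y A))) (unflatten-flatten (wedge (rows d (poly y B))))
    vanish : ∀ {p q} → Sub.∣ proj₁ p ─ proj₂ q ∣ ℕ.< d × Sub.∣ proj₂ q ─ proj₁ p ∣ ℕ.< d → Pairs≡0 (system p) (system q)
    vanish {A , _} {_ , B} (lt , lt′) = trans (eval-system A B) (pairing≡0 d A B y lt lt′)
    nonvanish : ∀ {p} → pair p y ≢ 0ℤ → Nondegenerate (system p)
    nonvanish {A , B} nz eq = nz (trans (sym (eval-system A B)) eq)

-- Decision procedures, existence of minima, and isolated vertices.

module Decidability where

  open import Data.Bool.Properties using () renaming (_≟_ to _≟ᵇ_)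
  import Data.Empty
  open import Data.Nat
  open import Data.Nat.Properties
  open import Data.Nat.Combinatorics using (_C_; nCk+nC[k+1]≡[n+1]C[k+1])
  open import Data.Fin using (toℕ)
  import Data.Fin.Properties as Finₚ
  open import Data.Fin.Subset hiding (⊤; ⊥; _∈_; _∉_)
  open import Data.Fin.Subset.Properties using (anySubset?; drop-∷-⊆; out⊆; in⊆in; p⊆q⇒∣p∣≤∣q∣; ∩-comm)
  open import Data.Fin.Subset.Properties renaming (_∈?_ to _∈ₛ?_) using ()
  open import Data.List as List using (List; []; _∷_; length; _++_; map)
  import Data.List.Properties as Listₚ
  import Data.List.Membership.DecPropositional as DecMembership
  open import Data.List.Membership.Propositional using (_∈_; _∉_)
  open import Data.List.Membership.Propositional.Properties
  open import Data.List.Relation.Unary.All as All using (All; []; _∷_)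
  import Data.List.Relation.Unary.All.Properties as Allₚ
  open import Data.List.Relation.Unary.AllPairs as AllPairs using ([]; _∷_)
  open import Data.List.Relation.Unary.Any using (here; there)
  open import Data.List.Relation.Unary.Unique.Propositional using (Unique)
  import Data.List.Relation.Unary.Unique.Propositional.Properties as Uniqueₚ
  open import Data.Product using (∃; _×_; _,_; proj₁)
  open import Data.Sum using (_⊎_; inj₁; inj₂)
  open import Data.Vec as Vec using ([]; _∷_; here; there)
  import Data.Vec.Properties as Vecₚ
  open import Function using (_∘_)
  open import Relation.Nullary using (Dec; yes; no; ¬_; contradiction)
  open import Relation.Nullary.Decidable using (map′; _×-dec_; _⊎-dec_; _→-dec_; ¬?; decidable-stable)
  open import Relation.Unary using (Decidable)
  open import Relation.Binary using (DecidableEquality)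
  open import Relation.Binary.PropositionalEquality
  open import Defs
  open TriangularSystem using (nC0≡1)

  private variable
    n k : ℕ

  unique⊆⇒length≤ : ∀ {A : Set} {xs ys : List A} → Unique xs → (∀ {x} → x ∈ xs → x ∈ ys) → length xs ≤ length ys
  unique⊆⇒length≤ []          xs⊆ys = z≤n
  unique⊆⇒length≤ {A} {x ∷ xs} (x∉ ∷ u) xs⊆ys with ∈-∃++ (xs⊆ys (here refl))
  ... | as , bs , refl = begin
    suc (length xs)          ≤⟨ s≤s (unique⊆⇒length≤ u λ y∈ → skip (λ { refl → All.lookup x∉ y∈ refl }) (xs⊆ys (there y∈))) ⟩
    suc (length (as ++ bs))  ≡⟨ cong suc (Listₚ.length-++ as) ⟩
    suc (length as + length bs) ≡⟨ +-suc (length as) (length bs) ⟨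
    length as + length (x ∷ bs) ≡⟨ Listₚ.length-++ as ⟨
    length (as ++ x ∷ bs) ∎
    where
    open ≤-Reasoning
    skip : ∀ {y} → y ≢ x → y ∈ as ++ x ∷ bs → y ∈ as ++ bs
    skip y≢x y∈ with ∈-++⁻ as y∈
    ... | inj₁ y∈as         = ∈-++⁺ˡ y∈as
    ... | inj₂ (here y≡x)   = contradiction y≡x y≢x
    ... | inj₂ (there y∈bs) = ∈-++⁺ʳ as y∈bs

  _≟ₛ_ : DecidableEquality (Subset n)
  _≟ₛ_ = Vecₚ.≡-dec _≟ᵇ_

  _∈?_ : (x : Subset n) (xs : List (Subset n)) → Dec (x ∈ xs)
  _∈?_ = DecMembership._∈?_ _≟ₛ_

  allSubset? : ∀ {P : Subset n → Set} → Decidable P → Dec (∀ p → P p)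
  allSubset? P? = map′ (λ ¬∃¬ p → decidable-stable (P? p) λ ¬Pp → ¬∃¬ (p , ¬Pp))
                       (λ ∀P (p , ¬Pp) → ¬Pp (∀P p))
                       (¬? (anySubset? (¬? ∘ P?)))

  -- The subsets x with L ⊆ x ⊆ U having exactly j elements outside L.
  between : Subset n → Subset n → ℕ → List (Subset n)
  between []            []            zero    = [] ∷ []
  between []            []            (suc j) = []
  between (inside  ∷ L) (inside  ∷ U) j       = map (inside ∷_) (between L U j)
  between (inside  ∷ L) (outside ∷ U) j       = []
  between (outside ∷ L) (outside ∷ U) j       = map (outside ∷_) (between L U j)
  between (outside ∷ L) (inside  ∷ U) zero    = map (outside ∷_) (between L U zero)
  between (outside ∷ L) (inside  ∷ U) (suc j) =
    map (inside ∷_) (between L U j) ++ map (outside ∷_) (between L U (suc j))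

  length-between : (L U : Subset n) (j : ℕ) → L ⊆ U → length (between L U j) ≡ ∣ U ─ L ∣ C j
  length-between []            []            zero    _   = refl
  length-between []            []            (suc j) _   = refl
  length-between (inside  ∷ L) (inside  ∷ U) j       L⊆U =
    trans (Listₚ.length-map _ (between L U j)) (length-between L U j (drop-∷-⊆ L⊆U))
  length-between (inside  ∷ L) (outside ∷ U) j       L⊆U with () ← L⊆U here
  length-between (outside ∷ L) (outside ∷ U) j       L⊆U =
    trans (Listₚ.length-map _ (between L U j)) (length-between L U j (drop-∷-⊆ L⊆U))
  length-between (outside ∷ L) (inside  ∷ U) zero    L⊆U =
    trans (Listₚ.length-map _ (between L U zero)) (trans (length-between L U zero (drop-∷-⊆ L⊆U))
      (trans (nC0≡1 ∣ U ─ L ∣) (sym (nC0≡1 (suc ∣ U ─ L ∣)))))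
  length-between (outside ∷ L) (inside  ∷ U) (suc j) L⊆U = begin
    length (map (inside ∷_) (between L U j) ++ map (outside ∷_) (between L U (suc j)))
      ≡⟨ Listₚ.length-++ (map (inside ∷_) (between L U j)) ⟩
    length (map (inside ∷_) (between L U j)) + length (map (outside ∷_) (between L U (suc j)))
      ≡⟨ cong₂ _+_ (Listₚ.length-map _ (between L U j)) (Listₚ.length-map _ (between L U (suc j))) ⟩
    length (between L U j) + length (between L U (suc j))
      ≡⟨ cong₂ _+_ (length-between L U j (drop-∷-⊆ L⊆U)) (length-between L U (suc j) (drop-∷-⊆ L⊆U)) ⟩
    ∣ U ─ L ∣ C j + ∣ U ─ L ∣ C suc j
      ≡⟨ nCk+nC[k+1]≡[n+1]C[k+1] ∣ U ─ L ∣ j ⟩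
    suc ∣ U ─ L ∣ C suc j ∎
    where open ≡-Reasoning

  unique-between : (L U : Subset n) (j : ℕ) → Unique (between L U j)
  unique-between []            []            zero    = [] ∷ []
  unique-between []            []            (suc j) = []
  unique-between (inside  ∷ L) (inside  ∷ U) j       = Uniqueₚ.map⁺ Vecₚ.∷-injectiveʳ (unique-between L U j)
  unique-between (inside  ∷ L) (outside ∷ U) j       = []
  unique-between (outside ∷ L) (outside ∷ U) j       = Uniqueₚ.map⁺ Vecₚ.∷-injectiveʳ (unique-between L U j)
  unique-between (outside ∷ L) (inside  ∷ U) zero    = Uniqueₚ.map⁺ Vecₚ.∷-injectiveʳ (unique-between L U zero)
  unique-between (outside ∷ L) (inside  ∷ U) (suc j) = Uniqueₚ.++⁺
    (Uniqueₚ.map⁺ Vecₚ.∷-injectiveʳ (unique-between L U j))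
    (Uniqueₚ.map⁺ Vecₚ.∷-injectiveʳ (unique-between L U (suc j)))
    λ (v∈ , v∈′) → case-heads (∈-map⁻ (inside ∷_) v∈) (∈-map⁻ (outside ∷_) v∈′)
    where
    case-heads : ∀ {v : Subset (suc n)} {P Q : Subset n → Set} →
      ∃ (λ x → P x × v ≡ inside ∷ x) → ∃ (λ x → Q x × v ≡ outside ∷ x) → Data.Empty.⊥
    case-heads (_ , _ , refl) (_ , _ , ())

  ∈-between⁺ : (L U : Subset n) {x : Subset n} (j : ℕ) → L ⊆ x → x ⊆ U → ∣ x ∣ ≡ ∣ L ∣ + j → x ∈ between L U j
  ∈-between⁺ []            []            {[]}          zero    _   _   _  = here refl
  ∈-between⁺ (inside  ∷ L) U             {outside ∷ x} j       L⊆x _   _  with () ← L⊆x here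
  ∈-between⁺ L             (outside ∷ U) {inside  ∷ x} j       _   x⊆U _  with () ← x⊆U here
  ∈-between⁺ (inside  ∷ L) (inside  ∷ U) {inside  ∷ x} j       L⊆x x⊆U eq =
    ∈-map⁺ _ (∈-between⁺ L U j (drop-∷-⊆ L⊆x) (drop-∷-⊆ x⊆U) (suc-injective eq))
  ∈-between⁺ (outside ∷ L) (outside ∷ U) {outside ∷ x} j       L⊆x x⊆U eq =
    ∈-map⁺ _ (∈-between⁺ L U j (drop-∷-⊆ L⊆x) (drop-∷-⊆ x⊆U) eq)
  ∈-between⁺ (outside ∷ L) (inside  ∷ U) {outside ∷ x} zero    L⊆x x⊆U eq =
    ∈-map⁺ _ (∈-between⁺ L U zero (drop-∷-⊆ L⊆x) (drop-∷-⊆ x⊆U) eq)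
  ∈-between⁺ (outside ∷ L) (inside  ∷ U) {outside ∷ x} (suc j) L⊆x x⊆U eq =
    ∈-++⁺ʳ (map (inside ∷_) (between L U j)) (∈-map⁺ _ (∈-between⁺ L U (suc j) (drop-∷-⊆ L⊆x) (drop-∷-⊆ x⊆U) eq))
  ∈-between⁺ (outside ∷ L) (inside  ∷ U) {inside  ∷ x} zero    L⊆x x⊆U eq =
    contradiction (≤-trans (≤-reflexive (trans eq (+-identityʳ _))) (p⊆q⇒∣p∣≤∣q∣ (drop-∷-⊆ L⊆x))) 1+n≰n
  ∈-between⁺ (outside ∷ L) (inside  ∷ U) {inside  ∷ x} (suc j) L⊆x x⊆U eq =
    ∈-++⁺ˡ (∈-map⁺ _ (∈-between⁺ L U j (drop-∷-⊆ L⊆x) (drop-∷-⊆ x⊆U) (suc-injective (trans eq (+-suc _ j)))))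

  ∈-between⁻ : (L U : Subset n) {x : Subset n} (j : ℕ) → x ∈ between L U j → L ⊆ x × x ⊆ U × ∣ x ∣ ≡ ∣ L ∣ + j
  ∈-between⁻ []            []            zero    (here refl) = (λ ()) , (λ ()) , refl
  ∈-between⁻ (inside  ∷ L) (inside  ∷ U) j       x∈ with ∈-map⁻ (inside ∷_) x∈
  ... | y , y∈ , refl = let p , q , eq = ∈-between⁻ L U j y∈ in in⊆in p , in⊆in q , cong suc eq
  ∈-between⁻ (outside ∷ L) (outside ∷ U) j       x∈ with ∈-map⁻ (outside ∷_) x∈
  ... | y , y∈ , refl = let p , q , eq = ∈-between⁻ L U j y∈ in out⊆ p , out⊆ q , eq
  ∈-between⁻ (outside ∷ L) (inside  ∷ U) zero    x∈ with ∈-map⁻ (outside ∷_) x∈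
  ... | y , y∈ , refl = let p , q , eq = ∈-between⁻ L U zero y∈ in out⊆ p , out⊆ q , eq
  ∈-between⁻ (outside ∷ L) (inside  ∷ U) (suc j) x∈ with ∈-++⁻ (map (inside ∷_) (between L U j)) x∈
  ... | inj₁ x∈₁ with y , y∈ , refl ← ∈-map⁻ (inside ∷_) x∈₁ =
    let p , q , eq = ∈-between⁻ L U j y∈ in out⊆ p , in⊆in q , trans (cong suc eq) (sym (+-suc _ j))
  ... | inj₂ x∈₂ with y , y∈ , refl ← ∈-map⁻ (outside ∷_) x∈₂ =
    let p , q , eq = ∈-between⁻ L U (suc j) y∈ in out⊆ p , out⊆ q , eq

  allSubsets : ∀ n → List (Subset n)
  allSubsets zero    = [] ∷ []
  allSubsets (suc n) = map (inside ∷_) (allSubsets n) ++ map (outside ∷_) (allSubsets n)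

  ∈-allSubsets : (x : Subset n) → x ∈ allSubsets n
  ∈-allSubsets []            = here refl
  ∈-allSubsets (inside  ∷ x) = ∈-++⁺ˡ (∈-map⁺ _ (∈-allSubsets x))
  ∈-allSubsets (outside ∷ x) = ∈-++⁺ʳ (map (inside ∷_) (allSubsets _)) (∈-map⁺ _ (∈-allSubsets x))

  -- Saturating [] under Step enumerates P, in finitely many rounds because the list stays duplicate-free.
  module Saturation {n} (P : Subset n → Set) (Step : List (Subset n) → Subset n → Set)
    (step? : ∀ K x → Dec (Step K x))
    (sound : ∀ {K x} → All P K → Step K x → P x)
    (progress : ∀ {K x} → P x → x ∉ K → ∃ λ y → y ∉ K × Step K y)
    where

    grow : ∀ fuel K → Unique K → All P K →
      (∃ λ D → All P D × ∀ {x} → P x → x ∈ D) ⊎ (∃ λ (D : List (Subset n)) → Unique D × fuel + length K ≤ length D)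
    grow zero    K u p = inj₂ (K , u , ≤-refl)
    grow (suc f) K u p with anySubset? (λ x → ¬? (x ∈? K) ×-dec step? K x)
    ... | no closed = inj₁ (K , p , λ {x} Px → decidable-stable (x ∈? K) λ x∉K → closed (progress Px x∉K))
    ... | yes (x , x∉K , s) with grow f (x ∷ K) (Allₚ.¬Any⇒All¬ K x∉K ∷ u) (sound p s ∷ p)
    ...   | inj₁ done         = inj₁ done
    ...   | inj₂ (D , uD , l) = inj₂ (D , uD , ≤-trans (≤-reflexive (sym (+-suc f (length K)))) l)

    enumeration : ∃ λ D → All P D × ∀ {x} → P x → x ∈ D
    -- One round more than there are subsets: a duplicate-free list of that length is impossible.
    enumeration with grow (suc (length (allSubsets n))) [] [] []
    ... | inj₁ done        = done
    ... | inj₂ (D , u , l) = contradiction (unique⊆⇒length≤ {ys = allSubsets n} u (λ {x} _ → ∈-allSubsets x))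
                                           (<⇒≱ (≤-trans (≤-reflexive (cong suc (sym (+-identityʳ _)))) l))

    decide : ∀ x → Dec (P x)
    decide x = let D , all , complete = enumeration in map′ (All.lookup all) complete (x ∈? D)

  anyList? : ∀ m {P : List (Subset n) → Set} → Decidable P → Dec (∃ λ B → P B × length B ≡ m)
  anyList? zero    P? = map′ (λ P[] → [] , P[] , refl) (λ { ([] , P[] , _) → P[] }) (P? [])
  anyList? (suc m) {P} P? = map′
    (λ (x , B , PxB , len) → x ∷ B , PxB , cong suc len)
    (λ { (x ∷ B , PxB , len) → x , B , PxB , suc-injective len })
    (anySubset? λ x → anyList? m {λ B → P (x ∷ B)} λ B → P? (x ∷ B))

  -- A search from 0 upwards, which ends because m is a known solution; deciding `P` at each step is
  -- what the procedures below provide.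
  minimum : ∀ {P : ℕ → Set} → Decidable P → ∀ {m} → P m → ∃ λ μ → IsMinimum P μ
  minimum {P} P? {m} Pm = search m 0 (+-identityʳ m) λ ()
    where
    search : ∀ fuel i → fuel + i ≡ m → (∀ {j} → j < i → ¬ P j) → ∃ (IsMinimum P)
    search zero    i refl below = i , Pm , λ j Pj → ≮⇒≥ λ j<i → below j<i Pj
    search (suc f) i eq   below with P? i
    ... | yes Pi = i , Pi , λ j Pj → ≮⇒≥ λ j<i → below j<i Pj
    ... | no ¬Pi = search f (suc i) (trans (+-suc f i) eq) λ {j} j<1+i Pj → case-≤ (m<1+n⇒m<n∨m≡n j<1+i) Pj
      where
      case-≤ : ∀ {j} → j < i ⊎ j ≡ i → ¬ P j
      case-≤ (inj₁ j<i)  = below j<i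
      case-≤ (inj₂ refl) = ¬Pi

  module Graph (n k : ℕ) (S : Subset k) where

    _~_ : Subset n → Subset n → Set
    _~_ = Adj n k S

    Vertex : Subset n → Set
    Vertex = IsVtx n k

    vertex? : Decidable Vertex
    vertex? u = ∣ u ∣ ≟ k

    _~?_ : ∀ u v → Dec (u ~ v)
    u ~? v = ¬? (u ≟ₛ v) ×-dec Finₚ.any? λ i → (i ∈ₛ? S) ×-dec (toℕ i ≟ ∣ u ∩ v ∣)

    ~-sym : ∀ {u v} → u ~ v → v ~ u
    ~-sym {u} {v} (u≢v , i , i∈S , eq) = u≢v ∘ sym , i , i∈S , trans eq (cong ∣_∣ (∩-comm u v))

    OnlyWhiteNeighbour : List (Subset n) → Subset n → Subset n → Set
    OnlyWhiteNeighbour K u w = ∀ x → Vertex x → u ~ x → x ≢ w → x ∈ K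

    onlyWhiteNeighbour? : ∀ K u w → Dec (OnlyWhiteNeighbour K u w)
    onlyWhiteNeighbour? K u w =
      allSubset? λ x → vertex? x →-dec ((u ~? x) →-dec (¬? (x ≟ₛ w) →-dec (x ∈? K)))

    Forces : List (Subset n) → Subset n → Subset n → Set
    Forces K u w = u ∈ K × Vertex u × Vertex w × u ~ w × OnlyWhiteNeighbour K u w

    BlackStep : List (Subset n) → List (Subset n) → Subset n → Set
    BlackStep B K x = x ∈ B ⊎ ∃ λ u → Forces K u x

    blackStep? : ∀ B K x → Dec (BlackStep B K x)
    blackStep? B K x = (x ∈? B) ⊎-dec anySubset? λ u →
      (u ∈? K) ×-dec (vertex? u ×-dec (vertex? x ×-dec ((u ~? x) ×-dec onlyWhiteNeighbour? K u x)))

    black-sound : ∀ {B K x} → All (Black n k S B) K → BlackStep B K x → Black n k S B x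
    black-sound blacks (inj₁ x∈B) = init x∈B
    black-sound blacks (inj₂ (u , u∈K , vu , vx , u~x , only)) =
      force vu (All.lookup blacks u∈K) vx u~x λ y vy u~y y≢x → All.lookup blacks (only y vy u~y y≢x)

    -- Descending the derivation of x leads to a vertex outside K all of whose premises lie in K.
    -- Besides completeness of the enumeration, this supplies the next force in the lower bound.
    black-progress : ∀ {B K x} → Black n k S B x → x ∉ K → ∃ λ y → y ∉ K × BlackStep B K y
    black-progress {x = x} (init x∈B) x∉K = x , x∉K , inj₁ x∈B
    black-progress {B} {K} {w} (force {u} vu bu vw u~w others) w∉K with u ∈? K
    ... | no u∉K = black-progress bu u∉K
    ... | yes u∈K with anySubset? (λ x → ¬? (x ∈? K) ×-dec (vertex? x ×-dec ((u ~? x) ×-dec ¬? (x ≟ₛ w))))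
    ...   | yes (x , x∉K , vx , u~x , x≢w) = black-progress (others x vx u~x x≢w) x∉K
    ...   | no none = w , w∉K , inj₂ (u , u∈K , vu , vw , u~w , λ x vx u~x x≢w →
              decidable-stable (x ∈? K) λ x∉K → none (x , x∉K , vx , u~x , x≢w))

    black? : ∀ B x → Dec (Black n k S B x)
    black? B = Saturation.decide (Black n k S B) (BlackStep B) (blackStep? B) black-sound black-progress

    ReachStep : List (Subset n) → Subset n → List (Subset n) → Subset n → Set
    ReachStep B u K x = x ≡ u ⊎ (x ∈ B × ∃ λ w → w ∈ K × w ~ x)

    reach-sound : ∀ {B u K x} → All (Reach n k S B u) K → ReachStep B u K x → Reach n k S B u x
    reach-sound _     (inj₁ refl)                  = here
    reach-sound reach (inj₂ (x∈B , w , w∈K , w~x)) = step (All.lookup reach w∈K) x∈B w~x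

    reach-progress : ∀ {B u K x} → Reach n k S B u x → x ∉ K → ∃ λ y → y ∉ K × ReachStep B u K y
    reach-progress {u = u} here u∉K = u , u∉K , inj₁ refl
    reach-progress {K = K} (step {w} {x} r x∈B w~x) x∉K with w ∈? K
    ... | yes w∈K = x , x∉K , inj₂ (x∈B , w , w∈K , w~x)
    ... | no w∉K  = reach-progress r w∉K

    reach? : ∀ B u v → Dec (Reach n k S B u v)
    reach? B u = Saturation.decide (Reach n k S B u) (ReachStep B u)
      (λ K x → (x ≟ₛ u) ⊎-dec ((x ∈? B) ×-dec anySubset? λ w → (w ∈? K) ×-dec (w ~? x)))
      reach-sound reach-progress

    zeroForcing? : Decidable (ZeroForcing n k S)
    zeroForcing? B = All.all? vertex? B ×-dec
      (AllPairs.allPairs? (λ x y → ¬? (x ≟ₛ y)) B ×-dec allSubset? λ v → vertex? v →-dec black? B v)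

    noIsolated? : Decidable (NoIsolated n k S)
    noIsolated? B = allSubset? λ u → (u ∈? B) →-dec anySubset? λ v → (v ∈? B) ×-dec (u ~? v)

    connected? : Decidable (Connected n k S)
    connected? B = allSubset? λ u → allSubset? λ v → (u ∈? B) →-dec ((v ∈? B) →-dec reach? B u v)

    zfSize? : ∀ {Q} → Decidable Q → Decidable (ZFSize n k S Q)
    zfSize? Q? m = map′ (λ (B , (zf , q) , len) → B , zf , q , len) (λ (B , zf , q , len) → B , (zf , q) , len)
      (anyList? m λ B → zeroForcing? B ×-dec Q? B)

    TwoNeighbours : Subset n → Set
    TwoNeighbours u = ∃ λ x → ∃ λ y → x ≢ y × (Vertex x × u ~ x) × (Vertex y × u ~ y)

    module _ (two-neighbours : ∀ {u} → Vertex u → TwoNeighbours u) where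

      -- If u alone is black and forces w, a second neighbour of u must already be black, hence
      -- equal to u, but u is not adjacent to itself.
      black-singleton : ∀ {B u} → (∀ {x} → x ∈ B → x ≡ u) → ∀ {x} → Black n k S B x → x ≡ u
      black-singleton B⊆u (init x∈B) = B⊆u x∈B
      black-singleton B⊆u (force {w = w} vv bv vw v~w others) with black-singleton B⊆u bv
      ... | refl with two-neighbours vv
      ...   | x , y , x≢y , (vx , v~x) , (vy , v~y) with x ≟ₛ w
      ...     | no x≢w   = contradiction (sym (black-singleton B⊆u (others x vx v~x x≢w))) (proj₁ v~x)
      ...     | yes refl = contradiction (sym (black-singleton B⊆u (others y vy v~y (x≢y ∘ sym)))) (proj₁ v~y)

      -- A nontrivial path to an isolated u would end with an edge from B to u, so connectedness
      -- gives B = {u}, and a single vertex forces nothing.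
      connected⇒noIsolated : ∀ {B} → ZeroForcing n k S B → Connected n k S B → NoIsolated n k S B
      connected⇒noIsolated {B} (vB , _ , blacks) conn u u∈B with anySubset? (λ v → (v ∈? B) ×-dec (u ~? v))
      ... | yes found = found
      ... | no none with two-neighbours (All.lookup vB u∈B)
      ...   | x , _ , _ , (vx , u~x) , _ = contradiction (sym (black-singleton singleton (blacks x vx))) (proj₁ u~x)
        where
        stays : ∀ {v} → v ∈ B → ∀ {w} → Reach n k S B v w → w ∈ B
        stays v∈B here           = v∈B
        stays v∈B (step _ w∈B _) = w∈B
        arrive : ∀ {v} → v ∈ B → Reach n k S B v u → v ≡ u
        arrive v∈B here           = refl
        arrive v∈B (step r _ w~u) = contradiction (_ , stays v∈B r , ~-sym w~u) none
        singleton : ∀ {v} → v ∈ B → v ≡ u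
        singleton {v} v∈B = arrive v∈B (conn v u v∈B u∈B)

-- Forcing sequences and the lower bound.

module ForcingChain where

  open import Data.Nat
  open import Data.Nat.Properties
  open import Data.Nat.Combinatorics using (_C_)
  open import Data.Fin using (toℕ; fromℕ<)
  import Data.Fin.Properties as Finₚ
  open import Data.Fin.Subset as Sub using (Subset; ∣_∣; _∩_; _─_)
  open import Data.Fin.Subset.Properties
    using (∣p∩q∣≤∣p∣; ∩-comm; ∩-idem; ∣⊤∣≡n; ∣⊥∣≡0; p─⊥≡p; ⊥⊆; ⊆⊤; anySubset?)
  open import Data.List as List using (List; []; _∷_; length; _++_; map)
  import Data.List.Properties as Listₚ
  open import Data.List.Membership.Propositional using (_∈_; _∉_)
  open import Data.List.Membership.Propositional.Properties
  open import Data.List.Relation.Unary.All as All using (All; []; _∷_)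
  open import Data.List.Relation.Unary.AllPairs using (AllPairs; []; _∷_)
  open import Data.List.Relation.Unary.Any using (here; there)
  open import Data.Product using (∃; _×_; _,_; proj₁; proj₂)
  open import Data.Sum using (inj₁; inj₂)
  open import Function using (_∘_)
  open import Function.Bundles using (_⇔_; Equivalence)
  open import Relation.Nullary using (yes; no; ¬_; contradiction)
  open import Relation.Nullary.Decidable using (_×-dec_; ¬?; decidable-stable)
  open import Relation.Binary.PropositionalEquality
  open import Defs
  open SubsetCardinality
  open Decidability
  open SkewBollobás

  vertices : ∀ n k → List (Subset n)
  vertices n k = between Sub.⊥ Sub.⊤ k

  length-vertices : ∀ n k → length (vertices n k) ≡ n C k
  length-vertices n k = trans (length-between {n} Sub.⊥ Sub.⊤ k ⊥⊆)
    (cong (_C k) (trans (cong ∣_∣ (p─⊥≡p {n} Sub.⊤)) (∣⊤∣≡n n)))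

  ∈-vertices⁺ : ∀ {n k} {x : Subset n} → ∣ x ∣ ≡ k → x ∈ vertices n k
  ∈-vertices⁺ {n} {k} eq = ∈-between⁺ Sub.⊥ Sub.⊤ k ⊥⊆ ⊆⊤ (trans eq (cong (_+ k) (sym (∣⊥∣≡0 n))))

  ∈-vertices⁻ : ∀ {n k} {x : Subset n} → x ∈ vertices n k → ∣ x ∣ ≡ k
  ∈-vertices⁻ {n} {k} x∈ = trans (proj₂ (proj₂ (∈-between⁻ Sub.⊥ Sub.⊤ k x∈))) (cong (_+ k) (∣⊥∣≡0 n))

  ∣p─q∣≡∣p∣∸∣p∩q∣ : ∀ {n} (p q : Subset n) → ∣ p ─ q ∣ ≡ ∣ p ∣ ∸ ∣ p ∩ q ∣
  ∣p─q∣≡∣p∣∸∣p∩q∣ p q = trans (sym (m+n∸m≡n ∣ p ∩ q ∣ ∣ p ─ q ∣)) (cong (_∸ ∣ p ∩ q ∣) (∣p∩q∣+∣p─q∣≡∣p∣ p q))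

  2k∸2t : ∀ k t → 2 * k ∸ 2 * t ≡ (k ∸ t) + (k ∸ t)
  2k∸2t k t = trans (sym (*-distribˡ-∸ 2 k t)) (cong ((k ∸ t) +_) (+-identityʳ (k ∸ t)))

  module LowerBound (n k : ℕ) (S : Subset k) (t : ℕ) (t<k : t < k)
    (S-initial : ∀ i → (i Sub.∈ S ⇔ toℕ i ≤ t)) where

    open Graph n k S

    adjacent⇒∩≤t : ∀ {u w} → u ~ w → ∣ u ∩ w ∣ ≤ t
    adjacent⇒∩≤t (_ , i , i∈S , eq) = subst (_≤ t) eq (Equivalence.to (S-initial i) i∈S)

    nonadjacent⇒t<∩ : ∀ {u w} → Vertex u → ¬ u ~ w → t < ∣ u ∩ w ∣
    nonadjacent⇒t<∩ {u} {w} vu ¬u~w with u ≟ₛ w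
    -- Equal vertices are not adjacent either; they meet in k > t elements.
    ... | yes refl = subst (t <_) (sym (trans (cong ∣_∣ (∩-idem u)) vu)) t<k
    ... | no u≢w = ≰⇒> λ ∩≤t → ¬u~w (u≢w , fromℕ< (≤-<-trans ∩≤t t<k)
            , Equivalence.from (S-initial _) (subst (_≤ t) (sym (Finₚ.toℕ-fromℕ< _)) ∩≤t) , Finₚ.toℕ-fromℕ< _)

    d : ℕ
    d = k ∸ t

    -- Forced vertices with their forcers, most recent first.
    record Chain (B : List (Subset n)) (L : List (Subset n × Subset n)) : Set where
      field
        diagonal  : All (λ (w , u) → d ≤ ∣ u ─ w ∣) L
        skew      : AllPairs (λ (w , _) (_ , u) → ∣ w ─ u ∣ < d × ∣ u ─ w ∣ < d) L
        exhausted : All (λ (_ , u) → Vertex u × (∀ x → Vertex x → u ~ x → x ∈ map proj₁ L ++ B)) L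

    -- A vertex that has forced has no white neighbour left, which `exhausted` remembers. The new w
    -- is still white, so it is not adjacent to any earlier forcer and meets each in more than t
    -- elements: this is the skew condition.
    extend : ∀ {B L w u} → Chain B L → w ∉ map proj₁ L ++ B → Forces (map proj₁ L ++ B) u w → Chain B ((w , u) ∷ L)
    extend {B} {L} {w} {u} c w∉ (u∈ , vu , vw , u~w , only) = record
      { diagonal = subst (d ≤_) (sym (∣p─q∣≡∣p∣∸∣p∩q∣ u w)) (∸-mono (≤-reflexive (sym vu)) (adjacent⇒∩≤t u~w))
                 ∷ diagonal
      ; skew = All.map (λ {(_ , v)} (vv , ex) → far w v vw vv (λ v~w → w∉ (ex w vw v~w))) exhausted ∷ skew
      ; exhausted = (vu , neighbour)
                  ∷ All.map (λ (vv , ex) → vv , λ x vx v~x → there (ex x vx v~x)) exhausted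
      }
      where
      open Chain c
      far : ∀ w v → Vertex w → Vertex v → ¬ v ~ w → ∣ w ─ v ∣ < d × ∣ v ─ w ∣ < d
      far w v vw vv ¬v~w =
          subst (_< d) (sym (∣p─q∣≡∣p∣∸∣p∩q∣ w v))
            (subst (λ m → m ∸ ∣ w ∩ v ∣ < d) (sym vw) (∸-monoʳ-< (subst (t <_) (cong ∣_∣ (∩-comm v w)) t<∩) (≤-trans (∣p∩q∣≤∣p∣ w v) (≤-reflexive vw))))
        , subst (_< d) (sym (∣p─q∣≡∣p∣∸∣p∩q∣ v w))
            (subst (λ m → m ∸ ∣ v ∩ w ∣ < d) (sym vv) (∸-monoʳ-< t<∩ (≤-trans (∣p∩q∣≤∣p∣ v w) (≤-reflexive vv))))
        where
        t<∩ : t < ∣ v ∩ w ∣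
        t<∩ = nonadjacent⇒t<∩ vv ¬v~w
      neighbour : ∀ x → Vertex x → u ~ x → x ∈ w ∷ (map proj₁ L ++ B)
      neighbour x vx u~x with x ≟ₛ w
      ... | yes refl = here refl
      ... | no x≢w   = there (only x vx u~x x≢w)

    chain-length : ∀ {B L} → Chain B L → length L ≤ (d + d) C d
    chain-length c = skew-bollobás d _ (Chain.diagonal c) (Chain.skew c)

    complete-chain : ∀ {B} → ZeroForcing n k S B → ∃ λ L → Chain B L × (∀ {x} → Vertex x → x ∈ map proj₁ L ++ B)
    -- Termination comes from the set-pair inequality itself: no chain is longer than (2d choose d),
    -- so one more round never happens.
    complete-chain {B} (_ , _ , blacks) = go (suc ((d + d) C d)) [] empty (m≤m+n _ 0)
      where
      empty : Chain B []
      empty = record { diagonal = [] ; skew = [] ; exhausted = [] }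
      go : ∀ fuel L → Chain B L → suc ((d + d) C d) ≤ fuel + length L →
        ∃ λ L → Chain B L × (∀ {x} → Vertex x → x ∈ map proj₁ L ++ B)
      go zero    L c enough = contradiction (chain-length c) (<⇒≱ enough)
      go (suc f) L c enough with anySubset? (λ x → vertex? x ×-dec ¬? (x ∈? (map proj₁ L ++ B)))
      ... | no covered = L , c , λ {x} vx → decidable-stable (x ∈? _) λ x∉ → covered (x , vx , x∉)
      ... | yes (x , vx , x∉) with black-progress (blacks x vx) x∉
      ...   | y , y∉ , inj₁ y∈B     = contradiction (∈-++⁺ʳ (map proj₁ L) y∈B) y∉
      ...   | y , y∉ , inj₂ (u , fs) = go f ((y , u) ∷ L) (extend c y∉ fs)
                                          (≤-trans enough (≤-reflexive (sym (+-suc f (length L)))))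

    bound≤ : ∀ {B} → ZeroForcing n k S B → bound n k t ≤ length B
    bound≤ {B} zf = m≤n+o⇒m∸n≤o (n C k) _ (begin
      n C k                             ≡⟨ length-vertices n k ⟨
      length (vertices n k)             ≤⟨ unique⊆⇒length≤ (unique-between Sub.⊥ Sub.⊤ k) (covers ∘ ∈-vertices⁻) ⟩
      length (map proj₁ L ++ B)         ≡⟨ Listₚ.length-++ (map proj₁ L) ⟩
      length (map proj₁ L) + length B   ≡⟨ cong (_+ length B) (Listₚ.length-map proj₁ L) ⟩
      length L + length B               ≤⟨ +-monoˡ-≤ (length B) (chain-length chain) ⟩
      (d + d) C d + length B            ≡⟨ cong (λ m → m C d + length B) (2k∸2t k t) ⟨
      (2 * k ∸ 2 * t) C d + length B ∎)
      where
      open ≤-Reasoning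
      L = proj₁ (complete-chain zf)
      chain = proj₁ (proj₂ (complete-chain zf))
      covers : ∀ {x} → Vertex x → x ∈ map proj₁ L ++ B
      covers = proj₂ (proj₂ (complete-chain zf))

-- The white family and the upper bound.

module WhiteFamily where

  open import Data.Nat hiding (∣_-_∣)
  open import Data.Nat.Properties
  open import Data.Nat.Combinatorics using (_C_; nCk+nC[k+1]≡[n+1]C[k+1])
  open import Data.Nat.Tactic.RingSolver using (solve-∀)
  open import Data.Fin using (Fin)
  open import Data.Fin.Subset as Sub using (Subset; ∣_∣; _∩_; _∪_; _─_; _-_; _⊆_; ⁅_⁆; ∁) renaming (_∈_ to _∈ₛ_; _∉_ to _∉ₛ_)
  open import Data.Fin.Subset.Properties renaming (_∈?_ to _∈ₛ?_)
  open import Data.List as List using (List; length; _++_; filter)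
  import Data.List.Properties as Listₚ
  open import Data.List.Membership.Propositional using (_∈_; _∉_)
  open import Data.List.Membership.Propositional.Properties
  import Data.List.Relation.Unary.All as All
  import Data.List.Relation.Unary.Unique.Propositional.Properties as Uniqueₚ
  open import Data.Product using (∃; _×_; _,_; proj₁; proj₂)
  open import Data.Sum using (inj₁; inj₂; [_,_]′)
  open import Function using (_∘_)
  open import Relation.Nullary using (yes; no; ¬_; contradiction)
  open import Relation.Nullary.Decidable using (¬?)
  open import Relation.Binary.PropositionalEquality
  open import Defs
  open SubsetCardinality
  open Decidability
  open ForcingChain

  -- Here d = 2 + e and k = t + d, so that the last field says ∣ M ∩ M′ ∣ < k.
  record Config (n t e : ℕ) : Set where
    field
      T M M′ : Subset n
      o      : Fin n
      T⊆M    : T ⊆ M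
      T⊆M′   : T ⊆ M′
      o∈M    : o ∈ₛ M
      o∈M′   : o ∈ₛ M′
      o∉T    : o ∉ₛ T
      ∣T∣    : ∣ T ∣ ≡ t
      ∣M∣    : ∣ M ∣ ≡ t + ((2 + e) + (2 + e))
      ∣M′∣   : ∣ M′ ∣ ≡ t + ((2 + e) + (2 + e))
      ∣M∩M′∣ : ∣ M ∩ M′ ∣ ≤ t + suc e

  -- M and M′ are a common Q of size k - 1 enlarged by disjoint sets J and J′ of size d + 1, which
  -- takes k - 1 + 2(d + 1) = t + 3d + 1 points. There is room for T and o in Q because d ≥ 2.
  config : ∀ n t e → suc (t + ((2 + e) + ((2 + e) + (2 + e)))) ≤ n → Config n t e
  config n t e large =
    let Q , _ , ∣Q∣     = choose {n} Sub.⊤ (t + suc e) (≤-trans (size₁ t e) (≤-trans large (≤-reflexive (sym (∣⊤∣≡n n)))))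
        T , T⊆Q , ∣T∣   = choose Q t (≤-trans (m≤m+n t (suc e)) (≤-reflexive (sym ∣Q∣)))
        o , o∈          = 0<∣p∣⇒nonempty (Q ─ T) (≤-trans (s≤s z≤n) (≤-reflexive (sym (+-cancelˡ-≡ t _ _
                            (trans (cong (_+ ∣ Q ─ T ∣) (sym ∣T∣)) (trans (q⊆p⇒∣q∣+∣p─q∣≡∣p∣ T⊆Q) ∣Q∣))))))
        o∈Q , o∉T       = x∈p─q⁻ Q T o∈
        J , J⊆ , ∣J∣    = choose (∁ Q) (3 + e) (≤-trans (m≤m+n (3 + e) (3 + e)) (size₂ {Q} ∣Q∣))
        J′ , J′⊆ , ∣J′∣ = choose (∁ Q ─ J) (3 + e) (+-cancelˡ-≤ (3 + e) _ _ (≤-trans (size₂ {Q} ∣Q∣)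
                            (≤-reflexive (trans (sym (q⊆p⇒∣q∣+∣p─q∣≡∣p∣ J⊆)) (cong (_+ ∣ ∁ Q ─ J ∣) ∣J∣)))))
        J′⊆∁Q : J′ ⊆ ∁ Q
        J′⊆∁Q x∈        = p─q⊆p (∁ Q) J (J′⊆ x∈)
    in record
      { T = T ; M = Q ∪ J ; M′ = Q ∪ J′ ; o = o
      ; T⊆M  = λ x∈T → p⊆p∪q J (T⊆Q x∈T)
      ; T⊆M′ = λ x∈T → p⊆p∪q J′ (T⊆Q x∈T)
      ; o∈M  = p⊆p∪q J o∈Q
      ; o∈M′ = p⊆p∪q J′ o∈Q
      ; o∉T  = o∉T
      ; ∣T∣  = ∣T∣
      ; ∣M∣  = size₃ {Q} {J} ∣Q∣ ∣J∣ (λ x∈Q x∈J → x∈∁p⇒x∉p (J⊆ x∈J) x∈Q)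
      ; ∣M′∣ = size₃ {Q} {J′} ∣Q∣ ∣J′∣ (λ x∈Q x∈J → x∈∁p⇒x∉p (J′⊆∁Q x∈J) x∈Q)
      ; ∣M∩M′∣ = ≤-trans (p⊆q⇒∣p∣≤∣q∣ (common Q J J′ λ x∈J x∈J′ → proj₂ (x∈p─q⁻ (∁ Q) J (J′⊆ x∈J′)) x∈J)) (≤-reflexive ∣Q∣)
      }
    where
    size₁ : ∀ t e → t + suc e ≤ suc (t + ((2 + e) + ((2 + e) + (2 + e))))
    size₁ t e = m≤n⇒m≤1+n (+-monoʳ-≤ t (≤-trans (n≤1+n (suc e)) (m≤m+n (2 + e) _)))
    size₂ : ∀ {Q : Subset n} → ∣ Q ∣ ≡ t + suc e → (3 + e) + (3 + e) ≤ ∣ ∁ Q ∣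
    size₂ {Q} ∣Q∣ = begin
      (3 + e) + (3 + e)                                        ≡⟨ m+n∸m≡n (t + suc e) _ ⟨
      (t + suc e) + ((3 + e) + (3 + e)) ∸ (t + suc e)          ≡⟨ cong (_∸ (t + suc e)) (identity t e) ⟩
      suc (t + ((2 + e) + ((2 + e) + (2 + e)))) ∸ (t + suc e)  ≤⟨ ∸-monoˡ-≤ (t + suc e) large ⟩
      n ∸ (t + suc e)                                          ≡⟨ cong (n ∸_) ∣Q∣ ⟨
      n ∸ ∣ Q ∣                                                ≡⟨ ∣∁p∣≡n∸∣p∣ Q ⟨
      ∣ ∁ Q ∣ ∎
      where
      open ≤-Reasoning
      identity : ∀ t e → (t + suc e) + ((3 + e) + (3 + e)) ≡ suc (t + ((2 + e) + ((2 + e) + (2 + e))))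
      identity = solve-∀
    size₃ : ∀ {Q J : Subset n} → ∣ Q ∣ ≡ t + suc e → ∣ J ∣ ≡ 3 + e → Disjoint Q J →
      ∣ Q ∪ J ∣ ≡ t + ((2 + e) + (2 + e))
    size₃ {Q} {J} ∣Q∣ ∣J∣ dis = trans (disjoint⇒∣p∪q∣≡∣p∣+∣q∣ Q J dis) (trans (cong₂ _+_ ∣Q∣ ∣J∣) (identity t e))
      where
      identity : ∀ t e → (t + suc e) + (3 + e) ≡ t + ((2 + e) + (2 + e))
      identity = solve-∀
    common : (Q J J′ : Subset n) → Disjoint J J′ → (Q ∪ J) ∩ (Q ∪ J′) ⊆ Q
    common Q J J′ dis x∈ with x∈p∩q⁻ (Q ∪ J) (Q ∪ J′) x∈
    ... | x∈₁ , x∈₂ with x∈p∪q⁻ Q J x∈₁ | x∈p∪q⁻ Q J′ x∈₂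
    ...   | inj₁ x∈Q | _         = x∈Q
    ...   | inj₂ _   | inj₁ x∈Q  = x∈Q
    ...   | inj₂ x∈J | inj₂ x∈J′ = contradiction x∈J′ (dis x∈J)

  module Construction (n t e : ℕ) (S : Subset (t + (2 + e))) (t-max : IsMax (t + (2 + e)) S t)
    (large : suc (t + ((2 + e) + ((2 + e) + (2 + e)))) ≤ n)
    (large′ : suc ((t + (2 + e)) + (t + (2 + e))) ≤ n) (cfg : Config n t e) where

    d k : ℕ
    d = 2 + e
    k = t + d

    open Graph n k S
    open Config cfg

    t<k : t < k
    t<k = m<m+n t (s≤s z≤n)

    -- The construction sees S only through this lemma and the next: intersections of size t = max S
    -- give edges, larger ones do not, and smaller ones are never examined.
    ∩≡t⇒adjacent : ∀ {u w} → Vertex u → ∣ u ∩ w ∣ ≡ t → u ~ w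
    ∩≡t⇒adjacent {u} vu eq = (λ { refl → <-irrefl (trans (sym eq) (trans (cong ∣_∣ (∩-idem u)) vu)) t<k })
      , proj₁ (proj₁ t-max) , proj₁ (proj₂ (proj₁ t-max)) , trans (proj₂ (proj₂ (proj₁ t-max))) (sym eq)

    t<∩⇒nonadjacent : ∀ {u w} → t < ∣ u ∩ w ∣ → ¬ u ~ w
    t<∩⇒nonadjacent t<∩ (_ , i , i∈S , eq) = <⇒≱ t<∩ (subst (_≤ t) eq (proj₂ t-max i i∈S))

    white₁ white₂ white : List (Subset n)
    white₁ = between T (M - o) d
    white₂ = between (T ∪ ⁅ o ⁆) M′ (suc e)
    white  = white₁ ++ white₂

    record White₁ (x : Subset n) : Set where
      constructor mk₁
      field
        T⊆x : T ⊆ x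
        x⊆M : x ⊆ M
        o∉x : o ∉ₛ x
        vx  : Vertex x

    record White₂ (x : Subset n) : Set where
      constructor mk₂
      field
        T⊆x  : T ⊆ x
        x⊆M′ : x ⊆ M′
        o∈x  : o ∈ₛ x
        vx   : Vertex x

    ∣T∪o∣ : ∣ T ∪ ⁅ o ⁆ ∣ ≡ suc t
    ∣T∪o∣ = trans (disjoint⇒∣p∪q∣≡∣p∣+∣q∣ T ⁅ o ⁆ (λ x∈T x∈o → o∉T (subst (_∈ₛ T) (x∈⁅y⁆⇒x≡y o x∈o) x∈T)))
      (trans (cong₂ _+_ ∣T∣ (∣⁅x⁆∣≡1 o)) (+-comm t 1))

    white₁⇒White₁ : ∀ {x} → x ∈ white₁ → White₁ x
    white₁⇒White₁ x∈ = let T⊆x , x⊆ , eq = ∈-between⁻ T (M - o) d x∈ in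
      mk₁ T⊆x (λ y∈x → proj₁ (x∈p-y⁻ M (x⊆ y∈x))) (λ o∈x → proj₂ (x∈p-y⁻ M (x⊆ o∈x)) refl) (trans eq (cong (_+ d) ∣T∣))

    white₂⇒White₂ : ∀ {x} → x ∈ white₂ → White₂ x
    white₂⇒White₂ x∈ = let T∪o⊆x , x⊆M′ , eq = ∈-between⁻ (T ∪ ⁅ o ⁆) M′ (suc e) x∈ in
      mk₂ (λ y∈T → T∪o⊆x (p⊆p∪q ⁅ o ⁆ y∈T)) x⊆M′ (T∪o⊆x (q⊆p∪q T ⁅ o ⁆ (x∈⁅x⁆ o)))
          (trans eq (trans (cong (_+ suc e) ∣T∪o∣) (sym (+-suc t (suc e)))))

    ∉white : ∀ {x} → ¬ White₁ x → ¬ White₂ x → x ∉ white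
    ∉white ¬w₁ ¬w₂ x∈ = [ ¬w₁ ∘ white₁⇒White₁ , ¬w₂ ∘ white₂⇒White₂ ]′ (∈-++⁻ white₁ x∈)

    -- The point o splits the d-subsets of a 2d-set: (2d - 1 choose d) of them omit it and (2d - 1
    -- choose d - 1) contain it. Replacing M by M′ in the second half does not change the count.
    length-white : length white ≡ (d + d) C d
    length-white = begin
      length white                  ≡⟨ Listₚ.length-++ white₁ ⟩
      length white₁ + length white₂ ≡⟨ cong₂ _+_ (trans (length-between T (M - o) d T⊆M-o) (cong (_C d) size₁))
                                                 (trans (length-between (T ∪ ⁅ o ⁆) M′ (suc e) T∪o⊆M′) (cong (_C suc e) size₂)) ⟩
      r C d + r C suc e             ≡⟨ +-comm (r C d) (r C suc e) ⟩
      r C suc e + r C d             ≡⟨ nCk+nC[k+1]≡[n+1]C[k+1] r (suc e) ⟩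
      suc r C d                     ∎
      where
      open ≡-Reasoning
      r : ℕ
      r = suc e + d
      T⊆M-o : T ⊆ M - o
      T⊆M-o x∈T = x∈p∧x≢y⇒x∈p-y (T⊆M x∈T) λ { refl → o∉T x∈T }
      T∪o⊆M′ : T ∪ ⁅ o ⁆ ⊆ M′
      T∪o⊆M′ = ∪-lub T⊆M′ (⁅x⁆⊆p o∈M′)
      size₁ : ∣ (M - o) ─ T ∣ ≡ r
      size₁ = +-cancelˡ-≡ t _ _ (suc-injective (begin
        suc (t + ∣ (M - o) ─ T ∣)      ≡⟨ cong (λ m → suc (m + ∣ (M - o) ─ T ∣)) ∣T∣ ⟨
        suc (∣ T ∣ + ∣ (M - o) ─ T ∣)  ≡⟨ cong suc (q⊆p⇒∣q∣+∣p─q∣≡∣p∣ T⊆M-o) ⟩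
        suc ∣ M - o ∣                  ≡⟨ cong (_+ ∣ M - o ∣) (∣⁅x⁆∣≡1 o) ⟨
        ∣ ⁅ o ⁆ ∣ + ∣ M - o ∣          ≡⟨ q⊆p⇒∣q∣+∣p─q∣≡∣p∣ (⁅x⁆⊆p o∈M) ⟩
        ∣ M ∣                          ≡⟨ ∣M∣ ⟩
        t + suc r                      ≡⟨ +-suc t r ⟩
        suc (t + r)                    ∎))
      size₂ : ∣ M′ ─ (T ∪ ⁅ o ⁆) ∣ ≡ r
      size₂ = +-cancelˡ-≡ (suc t) _ _ (begin
        suc t + ∣ M′ ─ (T ∪ ⁅ o ⁆) ∣             ≡⟨ cong (_+ ∣ M′ ─ (T ∪ ⁅ o ⁆) ∣) ∣T∪o∣ ⟨
        ∣ T ∪ ⁅ o ⁆ ∣ + ∣ M′ ─ (T ∪ ⁅ o ⁆) ∣     ≡⟨ q⊆p⇒∣q∣+∣p─q∣≡∣p∣ T∪o⊆M′ ⟩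
        ∣ M′ ∣                                   ≡⟨ ∣M′∣ ⟩
        t + suc r                                ≡⟨ +-suc t r ⟩
        suc (t + r)                              ∎)

    black : List (Subset n)
    black = filter (λ x → ¬? (x ∈? white)) (vertices n k)

    ∈-black⁺ : ∀ {x} → Vertex x → x ∉ white → x ∈ black
    ∈-black⁺ vx x∉ = ∈-filter⁺ (λ x → ¬? (x ∈? white)) (∈-vertices⁺ vx) x∉

    ∈-black⁻ : ∀ {x} → x ∈ black → Vertex x × x ∉ white
    ∈-black⁻ x∈ = let x∈V , x∉ = ∈-filter⁻ (λ x → ¬? (x ∈? white)) x∈ in ∈-vertices⁻ x∈V , x∉

    length-black : length black ≤ bound n k t
    length-black = m+n≤o⇒n≤o∸m (begin
      (2 * k ∸ 2 * t) C (k ∸ t) + length black  ≡⟨ cong (λ m → m C (k ∸ t) + length black) (2k∸2t k t) ⟩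
      ((k ∸ t) + (k ∸ t)) C (k ∸ t) + length black ≡⟨ cong (λ m → (m + m) C m + length black) (m+n∸m≡n t d) ⟩
      (d + d) C d + length black                ≡⟨ cong (_+ length black) length-white ⟨
      length white + length black               ≡⟨ Listₚ.length-++ white ⟨
      length (white ++ black)                   ≤⟨ unique⊆⇒length≤ unique ([ inWhite , (λ x∈B → ∈-vertices⁺ (proj₁ (∈-black⁻ x∈B))) ]′ ∘ ∈-++⁻ white) ⟩
      length (vertices n k)                     ≡⟨ length-vertices n k ⟩
      n C k ∎)
      where
      open ≤-Reasoning
      m+n≤o⇒n≤o∸m : ∀ {m n o} → m + n ≤ o → n ≤ o ∸ m
      m+n≤o⇒n≤o∸m {m} {n} {o} le = ≤-trans (≤-reflexive (sym (m+n∸m≡n m n))) (∸-monoˡ-≤ m le)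
      inWhite : ∀ {x} → x ∈ white → x ∈ vertices n k
      inWhite x∈ = ∈-vertices⁺ ([ White₁.vx ∘ white₁⇒White₁ , White₂.vx ∘ white₂⇒White₂ ]′ (∈-++⁻ white₁ x∈))
      unique = Uniqueₚ.++⁺
        (Uniqueₚ.++⁺ (unique-between T (M - o) d) (unique-between (T ∪ ⁅ o ⁆) M′ (suc e))
          λ (x∈₁ , x∈₂) → White₁.o∉x (white₁⇒White₁ x∈₁) (White₂.o∈x (white₂⇒White₂ x∈₂)))
        (Uniqueₚ.filter⁺ (λ x → ¬? (x ∈? white)) (unique-between Sub.⊥ Sub.⊤ k))
        λ (x∈W , x∈B) → proj₂ (∈-black⁻ x∈B) x∈W

    module Mirror (N : Subset n) (T⊆N : T ⊆ N) (∣N∣ : ∣ N ∣ ≡ t + (d + d))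
                  (w : Subset n) (T⊆w : T ⊆ w) (w⊆N : w ⊆ N) (vw : Vertex w) where

      mirror : Subset n
      mirror = T ∪ (N ─ w)

      mirror-vertex : Vertex mirror
      mirror-vertex = trans (disjoint⇒∣p∪q∣≡∣p∣+∣q∣ T (N ─ w) λ x∈T x∈ → proj₂ (x∈p─q⁻ N w x∈) (T⊆w x∈T))
        (cong₂ _+_ ∣T∣ (+-cancelˡ-≡ k _ _ (begin
          k + ∣ N ─ w ∣      ≡⟨ cong (_+ ∣ N ─ w ∣) vw ⟨
          ∣ w ∣ + ∣ N ─ w ∣  ≡⟨ q⊆p⇒∣q∣+∣p─q∣≡∣p∣ w⊆N ⟩
          ∣ N ∣              ≡⟨ ∣N∣ ⟩
          t + (d + d)        ≡⟨ +-assoc t d d ⟨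
          k + d ∎)))
        where open ≡-Reasoning

      mirror∩w : mirror ∩ w ≡ T
      mirror∩w = ⊆-antisym
        (λ x∈ → let x∈m , x∈w = x∈p∩q⁻ mirror w x∈ in
          [ (λ x∈T → x∈T) , (λ x∈N─w → contradiction x∈w (proj₂ (x∈p─q⁻ N w x∈N─w))) ]′ (x∈p∪q⁻ T (N ─ w) x∈m))
        (λ x∈T → x∈p∩q⁺ (p⊆p∪q (N ─ w) x∈T , T⊆w x∈T))

      mirror~w : mirror ~ w
      mirror~w = ∩≡t⇒adjacent mirror-vertex (trans (cong ∣_∣ mirror∩w) ∣T∣)

      N─w⊆mirror : N ─ w ⊆ mirror
      N─w⊆mirror = q⊆p∪q T (N ─ w)

      nonadjacent : ∀ {x y} → T ⊆ x → y ∈ₛ x → y ∈ₛ mirror → y ∉ₛ T → ¬ mirror ~ x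
      nonadjacent {x} {y} T⊆x y∈x y∈m y∉T = t<∩⇒nonadjacent (subst (_< ∣ mirror ∩ x ∣) ∣T∣
        (p⊂q⇒∣p∣<∣q∣ ((λ z∈T → x∈p∩q⁺ (p⊆p∪q (N ─ w) z∈T , T⊆x z∈T)) , y , x∈p∩q⁺ (y∈m , y∈x) , y∉T)))

      -- A k-set x other than w has a point outside w. Inside N that point belongs to the mirror, so
      -- x and the mirror share it in addition to T.
      nonadjacent-within : ∀ {x} → Vertex x → T ⊆ x → x ⊆ N → x ≢ w → ¬ mirror ~ x
      nonadjacent-within {x} vx T⊆x x⊆N x≢w =
        let y , y∈ = 0<∣p∣⇒nonempty (x ─ w) (n≢0⇒n>0 λ x─w≡0 → x≢w (⊆∧∣≡∣⇒≡ (sub x─w≡0) (trans vx (sym vw))))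
            y∈x , y∉w = x∈p─q⁻ x w y∈
        in nonadjacent T⊆x y∈x (N─w⊆mirror (x∈p∧x∉q⇒x∈p─q (x⊆N y∈x) y∉w)) (y∉w ∘ T⊆w)
        where
        sub : ∣ x ─ w ∣ ≡ 0 → x ⊆ w
        sub eq {y} y∈x with y ∈ₛ? w
        ... | yes y∈w = y∈w
        ... | no y∉w = contradiction eq (m<n⇒n≢0 (≤-trans (≤-reflexive (sym (∣⁅x⁆∣≡1 y)))
                         (p⊆q⇒∣p∣≤∣q∣ (⁅x⁆⊆p (x∈p∧x∉q⇒x∈p─q y∈x y∉w)))))

    isBlack₀ : ∀ {x} → Vertex x → x ∉ white → Black n k S black x
    isBlack₀ vx x∉ = init (∈-black⁺ vx x∉)

    -- The mirror contains o, so it is not of the first kind; it lies in M, so being of the second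
    -- kind would put its k elements into M ∩ M′, which is too small. White sets of the second kind
    -- share T and o with it and hence are not its neighbours.
    isBlack₁ : ∀ {w} → White₁ w → Black n k S black w
    isBlack₁ {w} (mk₁ T⊆w w⊆M o∉w vw) = force mirror-vertex (isBlack₀ mirror-vertex mirror∉) vw mirror~w others
      where
      open Mirror M T⊆M ∣M∣ w T⊆w w⊆M vw
      o∈mirror : o ∈ₛ mirror
      o∈mirror = N─w⊆mirror (x∈p∧x∉q⇒x∈p─q o∈M o∉w)
      mirror∉ : mirror ∉ white
      mirror∉ = ∉white (λ w₁ → White₁.o∉x w₁ o∈mirror) λ w₂ →
        <⇒≱ (≤-reflexive (sym (+-suc t (suc e)))) (≤-trans (≤-reflexive (sym mirror-vertex))
          (≤-trans (p⊆q⇒∣p∣≤∣q∣ λ x∈ → x∈p∩q⁺ (∪-lub T⊆M (p─q⊆p M w) x∈ , White₂.x⊆M′ w₂ x∈)) ∣M∩M′∣))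
      others : ∀ x → Vertex x → mirror ~ x → x ≢ w → Black n k S black x
      others x vx m~x x≢w with x ∈? white
      ... | no x∉ = isBlack₀ vx x∉
      ... | yes x∈ with ∈-++⁻ white₁ x∈
      ...   | inj₁ x∈₁ = let mk₁ T⊆x x⊆M _ _ = white₁⇒White₁ x∈₁ in contradiction m~x (nonadjacent-within vx T⊆x x⊆M x≢w)
      ...   | inj₂ x∈₂ = let mk₂ T⊆x _ o∈x _ = white₂⇒White₂ x∈₂ in contradiction m~x (nonadjacent T⊆x o∈x o∈mirror o∉T)

    -- Only the second kind is still white at this stage. The mirror omits o, so it is black by now,
    -- possibly after being forced itself.
    isBlack₂ : ∀ {w} → White₂ w → Black n k S black w
    isBlack₂ {w} (mk₂ T⊆w w⊆M′ o∈w vw) = force mirror-vertex blackMirror vw mirror~w others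
      where
      open Mirror M′ T⊆M′ ∣M′∣ w T⊆w w⊆M′ vw
      unless-White₂ : ∀ {x} → Vertex x → ¬ White₂ x → Black n k S black x
      unless-White₂ {x} vx ¬w₂ with x ∈? white
      ... | no x∉ = isBlack₀ vx x∉
      ... | yes x∈ with ∈-++⁻ white₁ x∈
      ...   | inj₁ x∈₁ = isBlack₁ (white₁⇒White₁ x∈₁)
      ...   | inj₂ x∈₂ = contradiction (white₂⇒White₂ x∈₂) ¬w₂
      blackMirror : Black n k S black mirror
      blackMirror = unless-White₂ mirror-vertex λ w₂ →
        [ o∉T , (λ o∈ → proj₂ (x∈p─q⁻ M′ w o∈) o∈w) ]′ (x∈p∪q⁻ T (M′ ─ w) (White₂.o∈x w₂))
      others : ∀ x → Vertex x → mirror ~ x → x ≢ w → Black n k S black x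
      others x vx m~x x≢w = unless-White₂ vx λ (mk₂ T⊆x x⊆M′ _ _) → nonadjacent-within vx T⊆x x⊆M′ x≢w m~x

    zeroForcing : ZeroForcing n k S black
    zeroForcing = All.tabulate (proj₁ ∘ ∈-black⁻) , Uniqueₚ.filter⁺ _ (unique-between Sub.⊥ Sub.⊤ k) , all-black
      where
      all-black : ∀ v → Vertex v → Black n k S black v
      all-black v vv with v ∈? white
      ... | no v∉ = isBlack₀ vv v∉
      ... | yes v∈ = [ isBlack₁ ∘ white₁⇒White₁ , isBlack₂ ∘ white₂⇒White₂ ]′ (∈-++⁻ white₁ v∈)

    attach : ∀ {p I O} → Vertex p → I ⊆ p → O ⊆ ∁ p → ∣ I ∣ ≡ t → ∣ O ∣ ≡ d → Vertex (I ∪ O) × p ~ (I ∪ O)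
    attach {p} {I} {O} vp I⊆p O⊆∁p ∣I∣ ∣O∣ =
        trans (disjoint⇒∣p∪q∣≡∣p∣+∣q∣ I O λ x∈I x∈O → x∈∁p⇒x∉p (O⊆∁p x∈O) (I⊆p x∈I)) (cong₂ _+_ ∣I∣ ∣O∣)
      , ∩≡t⇒adjacent vp (trans (cong ∣_∣ (⊆-antisym
          (λ x∈ → let x∈p , x∈IO = x∈p∩q⁻ p (I ∪ O) x∈ in
            [ (λ x∈I → x∈I) , (λ x∈O → contradiction x∈p (x∈∁p⇒x∉p (O⊆∁p x∈O))) ]′ (x∈p∪q⁻ I O x∈IO))
          (λ x∈I → x∈p∩q⁺ (I⊆p x∈I , p⊆p∪q O x∈I)))) ∣I∣)

    CommonBlackNeighbour : Subset n → Subset n → Set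
    CommonBlackNeighbour u v = ∃ λ x → x ∈ black × u ~ x × v ~ x

    common-neighbour : ∀ u v {I O} → Vertex u → Vertex v → I ⊆ u ∩ v → O ⊆ ∁ (u ∪ v) → ∣ I ∣ ≡ t → ∣ O ∣ ≡ d →
      I ∪ O ∉ white → CommonBlackNeighbour u v
    common-neighbour u v {I} {O} vu vv I⊆ O⊆ ∣I∣ ∣O∣ x∉ =
      let vx , u~x = attach vu (λ x∈I → p∩q⊆p u v (I⊆ x∈I)) (λ x∈O → p⊆q⇒∁p⊇∁q (p⊆p∪q v) (O⊆ x∈O)) ∣I∣ ∣O∣
          _  , v~x = attach vv (λ x∈I → p∩q⊆q u v (I⊆ x∈I)) (λ x∈O → p⊆q⇒∁p⊇∁q (q⊆p∪q u v) (O⊆ x∈O)) ∣I∣ ∣O∣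
      in I ∪ O , ∈-black⁺ vx x∉ , u~x , v~x

    T⊈x⇒∉white : ∀ {f x} → f ∈ₛ T → f ∉ₛ x → x ∉ white
    T⊈x⇒∉white f∈T f∉x = ∉white (λ w₁ → f∉x (White₁.T⊆x w₁ f∈T)) (λ w₂ → f∉x (White₂.T⊆x w₂ f∈T))

    outside-large : ∀ u v → Vertex u → Vertex v → k ≤ suc ∣ u ∩ v ∣ → n ≤ suc k + ∣ ∁ (u ∪ v) ∣
    outside-large u v vu vv close = begin
      n                                        ≡⟨ m+[n∸m]≡n (∣p∣≤n (u ∪ v)) ⟨
      ∣ u ∪ v ∣ + (n ∸ ∣ u ∪ v ∣)              ≡⟨ cong (∣ u ∪ v ∣ +_) (∣∁p∣≡n∸∣p∣ (u ∪ v)) ⟨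
      ∣ u ∪ v ∣ + ∣ ∁ (u ∪ v) ∣                ≤⟨ +-monoˡ-≤ ∣ ∁ (u ∪ v) ∣ (+-cancelʳ-≤ k ∣ u ∪ v ∣ (suc k) (begin
        ∣ u ∪ v ∣ + k                            ≤⟨ +-monoʳ-≤ ∣ u ∪ v ∣ close ⟩
        ∣ u ∪ v ∣ + suc ∣ u ∩ v ∣                ≡⟨ +-suc ∣ u ∪ v ∣ ∣ u ∩ v ∣ ⟩
        suc (∣ u ∪ v ∣ + ∣ u ∩ v ∣)              ≡⟨ cong suc (∣p∪q∣+∣p∩q∣≡∣p∣+∣q∣ u v) ⟩
        suc (∣ u ∣ + ∣ v ∣)                      ≡⟨ cong suc (cong₂ _+_ vu vv) ⟩
        suc k + k                                ∎)) ⟩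
      suc k + ∣ ∁ (u ∪ v) ∣                    ∎
      where open ≤-Reasoning

    -- The first bound on n reads n ≥ (k + 1) + 2d, and u ∪ v has at most k + 1 elements.
    2d≤outside : ∀ u v → Vertex u → Vertex v → k ≤ suc ∣ u ∩ v ∣ → d + d ≤ ∣ ∁ (u ∪ v) ∣
    2d≤outside u v vu vv close = +-cancelˡ-≤ (suc k) _ _
      (≤-trans (≤-reflexive (cong suc (+-assoc t d (d + d)))) (≤-trans large (outside-large u v vu vv close)))

    ∣M∩M′∣<∣M∣ : ∣ M ∩ M′ ∣ < ∣ M ∣
    ∣M∩M′∣<∣M∣ = begin-strict
      ∣ M ∩ M′ ∣      ≤⟨ ∣M∩M′∣ ⟩
      t + suc e       <⟨ +-monoʳ-< t (m≤m+n d d) ⟩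
      t + (d + d)     ≡⟨ ∣M∣ ⟨
      ∣ M ∣           ∎
      where open ≤-Reasoning

    -- The neighbour is I ∪ O with I ⊆ u ∩ v of size t and O outside u ∪ v of size d; the choice
    -- must avoid both white kinds. If T has a point, leave that point out. If T is empty and some y
    -- outside u ∪ v is not in M, include y and leave out o. Otherwise the complement of u ∪ v is M
    -- by size, and O takes o together with a point of M ∖ M′, for which d ≥ 2 suffices.
    common-black-neighbour : ∀ u v → Vertex u → Vertex v → k ≤ suc ∣ u ∩ v ∣ → CommonBlackNeighbour u v
    common-black-neighbour u v vu vv close with nonempty? T
    ... | yes (f , f∈T) =
      let I , I⊆ , ∣I∣ = choose ((u ∩ v) - f) t t≤
          O , O⊆ , ∣O∣ = choose (∁ (u ∪ v) - f) d d≤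
      in common-neighbour u v vu vv (λ x∈ → proj₁ (x∈p-y⁻ (u ∩ v) (I⊆ x∈))) (λ x∈ → proj₁ (x∈p-y⁻ (∁ (u ∪ v)) (O⊆ x∈))) ∣I∣ ∣O∣
           (T⊈x⇒∉white f∈T λ f∈ →
             [ (λ f∈I → proj₂ (x∈p-y⁻ (u ∩ v) (I⊆ f∈I)) refl) , (λ f∈O → proj₂ (x∈p-y⁻ (∁ (u ∪ v)) (O⊆ f∈O)) refl) ]′
               (x∈p∪q⁻ I O f∈))
      where
      open ≤-Reasoning
      1≤t : 1 ≤ t
      1≤t = subst (1 ≤_) ∣T∣ (≤-trans (≤-reflexive (sym (∣⁅x⁆∣≡1 f))) (p⊆q⇒∣p∣≤∣q∣ (⁅x⁆⊆p f∈T)))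
      t≤ : t ≤ ∣ (u ∩ v) - f ∣
      t≤ = +-cancelˡ-≤ 2 _ _ (begin
        2 + t                  ≤⟨ m≤m+n (2 + t) e ⟩
        2 + t + e              ≡⟨ identity t e ⟩
        k                      ≤⟨ close ⟩
        suc ∣ u ∩ v ∣          ≤⟨ s≤s (∣p∣≤1+∣p-x∣ (u ∩ v) f) ⟩
        2 + ∣ (u ∩ v) - f ∣    ∎)
        where
        identity : ∀ t e → 2 + t + e ≡ t + (2 + e)
        identity = solve-∀
      d≤ : d ≤ ∣ ∁ (u ∪ v) - f ∣
      -- By n ≥ 2k + 1 at least k = t + d ≥ 1 + d points lie outside u ∪ v, enough to spare f.
      d≤ = s≤s⁻¹ (begin
        suc d                     ≤⟨ +-monoˡ-≤ d 1≤t ⟩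
        k                         ≤⟨ +-cancelˡ-≤ (suc k) _ _ (≤-trans large′ (outside-large u v vu vv close)) ⟩
        ∣ ∁ (u ∪ v) ∣             ≤⟨ ∣p∣≤1+∣p-x∣ (∁ (u ∪ v)) f ⟩
        suc ∣ ∁ (u ∪ v) - f ∣     ∎)
    ... | no T-empty with nonempty? (∁ (u ∪ v) ─ M)
    ...   | yes (y , y∈) =
      let y∈U , y∉M = x∈p─q⁻ U M y∈
          O , y∈O , O⊆ , ∣O∣ = choose-between ⁅ y ⁆ (U - o) d
            (⁅x⁆⊆p (x∈p∧x≢y⇒x∈p-y y∈U λ { refl → y∉M o∈M }))
            (≤-trans (≤-reflexive (∣⁅x⁆∣≡1 y)) (s≤s z≤n)) d≤
      in common-neighbour u v vu vv ⊥⊆ (λ x∈ → proj₁ (x∈p-y⁻ U (O⊆ x∈))) ∣⊥∣≡t ∣O∣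
           (∉white (λ w₁ → y∉M (White₁.x⊆M w₁ (q⊆p∪q Sub.⊥ O (y∈O (x∈⁅x⁆ y)))))
                   (λ w₂ → [ ∉⊥ , (λ o∈O → proj₂ (x∈p-y⁻ U (O⊆ o∈O)) refl) ]′ (x∈p∪q⁻ Sub.⊥ O (White₂.o∈x w₂))))
      where
      U : Subset n
      U = ∁ (u ∪ v)
      ∣⊥∣≡t : ∣ Sub.⊥ {n} ∣ ≡ t
      ∣⊥∣≡t = trans (cong ∣_∣ (sym (Empty-unique T-empty))) ∣T∣
      d≤ : d ≤ ∣ U - o ∣
      d≤ = s≤s⁻¹ (≤-trans (+-monoˡ-≤ d (s≤s (z≤n {suc e}))) (≤-trans (2d≤outside u v vu vv close) (∣p∣≤1+∣p-x∣ U o)))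
    ...   | no U─M-empty =
      let y , y∈ = 0<∣p∣⇒nonempty (M ─ M′) (n≢0⇒n>0 λ eq → <⇒≱ ∣M∩M′∣<∣M∣
            (≤-reflexive (trans (sym (∣p∩q∣+∣p─q∣≡∣p∣ M M′)) (trans (cong (∣ M ∩ M′ ∣ +_) eq) (+-identityʳ _)))))
          y∈M , y∉M′ = x∈p─q⁻ M M′ y∈
          O , oy∈O , O⊆ , ∣O∣ = choose-between (⁅ o ⁆ ∪ ⁅ y ⁆) U d
            (∪-lub (⁅x⁆⊆p (M⊆U o∈M)) (⁅x⁆⊆p (M⊆U y∈M))) (two≤d y)
            (≤-trans (m≤m+n d d) (2d≤outside u v vu vv close))
      in common-neighbour u v vu vv ⊥⊆ O⊆ ∣⊥∣≡t ∣O∣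
           (∉white (λ w₁ → White₁.o∉x w₁ (q⊆p∪q Sub.⊥ O (oy∈O (p⊆p∪q ⁅ y ⁆ (x∈⁅x⁆ o)))))
                   (λ w₂ → y∉M′ (White₂.x⊆M′ w₂ (q⊆p∪q Sub.⊥ O (oy∈O (q⊆p∪q ⁅ o ⁆ ⁅ y ⁆ (x∈⁅x⁆ y)))))))
      where
      U : Subset n
      U = ∁ (u ∪ v)
      ∣⊥∣≡t : ∣ Sub.⊥ {n} ∣ ≡ t
      ∣⊥∣≡t = trans (cong ∣_∣ (sym (Empty-unique T-empty))) ∣T∣
      two≤d : ∀ y → ∣ ⁅ o ⁆ ∪ ⁅ y ⁆ ∣ ≤ d
      two≤d y = begin
        ∣ ⁅ o ⁆ ∪ ⁅ y ⁆ ∣                         ≤⟨ m≤m+n _ _ ⟩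
        ∣ ⁅ o ⁆ ∪ ⁅ y ⁆ ∣ + ∣ ⁅ o ⁆ ∩ ⁅ y ⁆ ∣     ≡⟨ ∣p∪q∣+∣p∩q∣≡∣p∣+∣q∣ ⁅ o ⁆ ⁅ y ⁆ ⟩
        ∣ ⁅ o ⁆ ∣ + ∣ ⁅ y ⁆ ∣                     ≡⟨ cong₂ _+_ (∣⁅x⁆∣≡1 o) (∣⁅x⁆∣≡1 y) ⟩
        2                                         ≤⟨ m≤m+n 2 e ⟩
        d                                         ∎
        where open ≤-Reasoning
      M⊆U : M ⊆ U
      M⊆U = p⊆q∧∣q∣≤∣p∣⇒q⊆p sub (≤-trans (≤-reflexive (trans ∣M∣ (cong (_+ (d + d)) t≡0))) (2d≤outside u v vu vv close))
        where
        t≡0 : t ≡ 0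
        t≡0 = trans (sym ∣⊥∣≡t) (∣⊥∣≡0 n)
        sub : U ⊆ M
        sub {x} x∈U with x ∈ₛ? M
        ... | yes x∈M = x∈M
        ... | no x∉M  = contradiction (x , x∈p∧x∉q⇒x∈p─q x∈U x∉M) U─M-empty

    -- `Reach` does not ask its starting point to be in the list, so it is not symmetric in general;
    -- carrying both directions avoids reversing paths.
    Linked : Subset n → Subset n → Set
    Linked u v = Reach n k S black u v × Reach n k S black v u

    reach-trans : ∀ {u v w} → Reach n k S black u v → Reach n k S black v w → Reach n k S black u w
    reach-trans r here           = r
    reach-trans r (step s w∈ ad) = step (reach-trans r s) w∈ ad

    linked-trans : ∀ {u v w} → Linked u v → Linked v w → Linked u w
    linked-trans (p , p′) (q , q′) = reach-trans p q , reach-trans q′ p′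

    linked-sym : ∀ {u v} → Linked u v → Linked v u
    linked-sym (p , p′) = p′ , p

    linked-close : ∀ {u v} → u ∈ black → v ∈ black → k ≤ suc ∣ u ∩ v ∣ → Linked u v
    linked-close {u} {v} u∈ v∈ close =
      let x , x∈ , u~x , v~x = common-black-neighbour u v (proj₁ (∈-black⁻ u∈)) (proj₁ (∈-black⁻ v∈)) close
      in step (step here x∈ u~x) v∈ (~-sym v~x) , step (step here x∈ v~x) u∈ (~-sym u~x)

    -- Every vertex is at most one swap away from the family of sets containing e but not f.
    black-family : ∃ λ e → ∃ λ f → e ≢ f × (∀ {x} → e ∈ₛ x → f ∉ₛ x → x ∉ white)
    black-family with nonempty? T
    ... | yes (f , f∈T) = o , f , (λ { refl → o∉T f∈T }) , λ _ → T⊈x⇒∉white f∈T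
    ... | no _ =
      let y , y∈ = 0<∣p∣⇒nonempty (M′ ─ M) (n≢0⇒n>0 λ eq → <⇒≱ ∣M∩M′∣<∣M∣ (≤-reflexive (begin
            ∣ M ∣                        ≡⟨ trans ∣M∣ (sym ∣M′∣) ⟩
            ∣ M′ ∣                       ≡⟨ ∣p∩q∣+∣p─q∣≡∣p∣ M′ M ⟨
            ∣ M′ ∩ M ∣ + ∣ M′ ─ M ∣      ≡⟨ cong₂ _+_ (cong ∣_∣ (∩-comm M′ M)) eq ⟩
            ∣ M ∩ M′ ∣ + 0               ≡⟨ +-identityʳ _ ⟩
            ∣ M ∩ M′ ∣                   ∎)))
          y∈M′ , y∉M = x∈p─q⁻ M′ M y∈
      in y , o , (λ y≡o → y∉M (subst (_∈ₛ M) (sym y≡o) o∈M))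
       , λ y∈x o∉x → ∉white (λ w₁ → y∉M (White₁.x⊆M w₁ y∈x)) (λ w₂ → o∉x (White₂.o∈x w₂))
      where open ≡-Reasoning

    module Swaps (in-e out-f : Fin n) (e≢f : in-e ≢ out-f)
      (avoids : ∀ {x} → in-e ∈ₛ x → out-f ∉ₛ x → x ∉ white) where

      record Family (x : Subset n) : Set where
        constructor family
        field
          vertex : Vertex x
          e∈     : in-e ∈ₛ x
          f∉     : out-f ∉ₛ x

      family⇒black : ∀ {x} → Family x → x ∈ black
      family⇒black (family vx e∈ f∉) = ∈-black⁺ vx (avoids e∈ f∉)

      linked-swap : ∀ {u a b} → u ∈ black → a ∈ₛ u → b ∉ₛ u → Family (swap u a b) → Linked u (swap u a b)
      linked-swap {u} u∈ a∈ b∉ fam = linked-close u∈ (family⇒black fam)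
        (subst (_≤ suc ∣ u ∩ swap u _ _ ∣) (proj₁ (∈-black⁻ u∈)) (∣u∣≤1+∣u∩swap∣ u a∈ b∉))

      -- Exchanging a ∈ u ∖ v for b ∈ v ∖ u moves u closer to v. Since v contains `in-e` and omits
      -- `out-f`, the exchange neither removes the former nor adds the latter, so every intermediate
      -- set is in the family and black.
      family-connected : ∀ m {u v} → ∣ v ─ u ∣ ≤ m → Family u → Family v → Linked u v
      family-connected m {u} {v} le fu fv with nonempty? (v ─ u)
      ... | no empty = subst (Linked u) (sym (⊆∧∣≡∣⇒≡ v⊆u (trans (Family.vertex fv) (sym (Family.vertex fu))))) (here , here)
        where
        v⊆u : v ⊆ u
        v⊆u {x} x∈v with x ∈ₛ? u
        ... | yes x∈u = x∈u
        ... | no x∉u  = contradiction (x , x∈p∧x∉q⇒x∈p─q x∈v x∉u) empty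
      ... | yes (b , b∈) = descend m le
        where
        b∈v = proj₁ (x∈p─q⁻ v u b∈)
        b∉u = proj₂ (x∈p─q⁻ v u b∈)
        v─u>0 : 0 < ∣ v ─ u ∣
        v─u>0 = ≤-trans (≤-reflexive (sym (∣⁅x⁆∣≡1 b))) (p⊆q⇒∣p∣≤∣q∣ (⁅x⁆⊆p b∈))
        a-exists = 0<∣p∣⇒nonempty (u ─ v) (subst (0 <_)
          (∣p∣≡∣q∣⇒∣p─q∣≡∣q─p∣ v u (trans (Family.vertex fv) (sym (Family.vertex fu)))) v─u>0)
        a = proj₁ a-exists
        a∈u = proj₁ (x∈p─q⁻ u v (proj₂ a-exists))
        a∉v = proj₂ (x∈p─q⁻ u v (proj₂ a-exists))
        u′ : Subset n
        u′ = swap u a b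
        fu′ : Family u′
        fu′ = family (trans (∣swap∣ u a∈u b∉u) (Family.vertex fu))
          (∈-swap⁺ u (Family.e∈ fu) λ e≡a → a∉v (subst (_∈ₛ v) e≡a (Family.e∈ fv)))
          λ f∈ → [ (λ (f∈u , _) → Family.f∉ fu f∈u) , (λ f≡b → Family.f∉ fv (subst (_∈ₛ v) (sym f≡b) b∈v)) ]′ (∈-swap⁻ u f∈)
        closer : ∣ v ─ u′ ∣ < ∣ v ─ u ∣
        closer = p⊂q⇒∣p∣<∣q∣ ((λ {x} x∈ → let x∈v , x∉u′ = x∈p─q⁻ v u′ x∈ in
            x∈p∧x∉q⇒x∈p─q x∈v λ x∈u → x∉u′ (∈-swap⁺ u x∈u λ x≡a → a∉v (subst (_∈ₛ v) x≡a x∈v)))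
          , b , b∈ , λ b∈′ → proj₂ (x∈p─q⁻ v u′ b∈′) (b∈swap u a b))
        descend : ∀ m → ∣ v ─ u ∣ ≤ m → Linked u v
        descend zero    le = contradiction le (<⇒≱ v─u>0)
        descend (suc m) le = linked-trans (linked-swap (family⇒black fu) a∈u b∉u fu′)
          (family-connected m (s≤s⁻¹ (≤-trans closer le)) fu′ fv)

      toFamily : ∀ {u} → u ∈ black → ∃ λ v → Family v × Linked u v
      toFamily {u} u∈ with proj₁ (∈-black⁻ u∈) | in-e ∈ₛ? u | out-f ∈ₛ? u
      ... | vu | yes e∈ | no f∉ = u , family vu e∈ f∉ , here , here
      ... | vu | yes e∈ | yes f∈ =
        let b , b∈ = 0<∣p∣⇒nonempty (∁ u) (subst (0 <_) (sym (∣∁p∣≡n∸∣p∣ u)) (m<n⇒0<n∸m (subst (_< n) (sym vu) k<n)))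
            b∉u = x∈∁p⇒x∉p b∈
            fam = family (trans (∣swap∣ u f∈ b∉u) vu) (∈-swap⁺ u e∈ e≢f)
                    λ f∈′ → [ (λ (_ , f≢f) → f≢f refl) , (λ f≡b → b∉u (subst (_∈ₛ u) f≡b f∈)) ]′ (∈-swap⁻ u f∈′)
        in swap u out-f b , fam , linked-swap u∈ f∈ b∉u fam
        where
        k<n : k < n
        k<n = ≤-trans (s≤s (m≤m+n k k)) large′
      ... | vu | no e∉ | yes f∈ =
        let fam = family (trans (∣swap∣ u f∈ e∉) vu) (b∈swap u out-f in-e)
                    λ f∈′ → [ (λ (_ , f≢f) → f≢f refl) , (λ f≡e → e≢f (sym f≡e)) ]′ (∈-swap⁻ u f∈′)
        in swap u out-f in-e , fam , linked-swap u∈ f∈ e∉ fam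
      ... | vu | no e∉ | no f∉ =
        let a , a∈ = 0<∣p∣⇒nonempty u (subst (0 <_) (sym vu) (≤-trans (s≤s z≤n) t<k))
            fam = family (trans (∣swap∣ u a∈ e∉) vu) (b∈swap u a in-e)
                    λ f∈′ → [ (λ (f∈u , _) → f∉ f∈u) , (λ f≡e → e≢f (sym f≡e)) ]′ (∈-swap⁻ u f∈′)
        in swap u a in-e , fam , linked-swap u∈ a∈ e∉ fam

      all-linked : Connected n k S black
      all-linked u v u∈ v∈ =
        let u′ , fu , lu = toFamily u∈
            v′ , fv , lv = toFamily v∈
        in proj₁ (linked-trans lu (linked-trans (family-connected _ ≤-refl fu fv) (linked-sym lv)))

    connected : Connected n k S black
    connected = let e , f , e≢f , avoids = black-family in Swaps.all-linked e f e≢f avoids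

    two-neighbours : ∀ {u} → Vertex u → TwoNeighbours u
    two-neighbours {u} vu =
      let I , I⊆u , ∣I∣ = choose u t (≤-trans (<⇒≤ t<k) (≤-reflexive (sym vu)))
          O , O⊆ , ∣O∣ = choose (∁ u) d (≤-trans (m≤n+m d t) (≤-trans (n≤1+n k) k<∁u))
          z , z∈O = 0<∣p∣⇒nonempty O (subst (0 <_) (sym ∣O∣) (s≤s z≤n))
          -- Leaving out a point z of O makes the second neighbour differ from the first; n ≥ 2k + 1
          -- gives more than k ≥ d points outside u.
          O′ , O′⊆ , ∣O′∣ = choose (∁ u - z) d (≤-trans (m≤n+m d t) (s≤s⁻¹ (≤-trans k<∁u (∣p∣≤1+∣p-x∣ (∁ u) z))))
      in I ∪ O , I ∪ O′
       , (λ eq → [ (λ z∈I → x∈∁p⇒x∉p (O⊆ z∈O) (I⊆u z∈I)) , (λ z∈O′ → proj₂ (x∈p-y⁻ (∁ u) (O′⊆ z∈O′)) refl) ]′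
                   (x∈p∪q⁻ I O′ (subst (z ∈ₛ_) eq (q⊆p∪q I O z∈O))))
       , attach vu I⊆u O⊆ ∣I∣ ∣O∣
       , attach vu I⊆u (λ x∈ → proj₁ (x∈p-y⁻ (∁ u) (O′⊆ x∈))) ∣I∣ ∣O′∣
      where
      k<∁u : suc k ≤ ∣ ∁ u ∣
      k<∁u = begin
        suc k          ≡⟨ m+n∸n≡m (suc k) k ⟨
        suc k + k ∸ k  ≤⟨ ∸-monoˡ-≤ k large′ ⟩
        n ∸ k          ≡⟨ cong (n ∸_) vu ⟨
        n ∸ ∣ u ∣      ≡⟨ ∣∁p∣≡n∸∣p∣ u ⟨
        ∣ ∁ u ∣        ∎
        where open ≤-Reasoning

-- The chain of inequalities.

open import Defs
open import Data.Nat
open import Data.Nat.Properties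
open import Data.Nat.Tactic.RingSolver using (solve-∀)
open import Data.Fin using (toℕ)
open import Data.Fin.Subset using (Subset; _∈_; Nonempty)
open import Data.List using (length)
open import Data.Product using (_×_; ∃; ∃-syntax; _,_)
open import Relation.Nullary using (yes)
open import Relation.Binary.PropositionalEquality
open import Function.Bundles using (_⇔_)
open Decidability
open ForcingChain
open WhiteFamily

Conclusion : (n k t : ℕ) → Subset k → Set
Conclusion n k t S = ∃[ z ] ∃[ zt ] ∃[ zc ]
  (IsZ n k S z × IsZt n k S zt × IsZc n k S zc ×
   z ≤ zt × zt ≤ zc × zc ≤ bound n k t ×
   ((∀ i → (i ∈ S ⇔ toℕ i ≤ t)) →
     z ≡ bound n k t × zt ≡ bound n k t × zc ≡ bound n k t))

-- The minima are found from the most restrictive notion downwards, each minimiser witnessing that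
-- the next minimum exists. For an initial segment S it then suffices to bound the smallest of the
-- three from below.
conclusion : ∀ n t e → Config n t e → (S : Subset (t + (2 + e))) → IsMax (t + (2 + e)) S t →
  suc (t + ((2 + e) + ((2 + e) + (2 + e)))) ≤ n → suc ((t + (2 + e)) + (t + (2 + e))) ≤ n →
  Conclusion n (t + (2 + e)) t S
conclusion n t e cfg S t-max large large′ =
  let zc , isZc@((Bc , zfc , connc , lenc) , minc) = minimum (zfSize? connected?) (black , zeroForcing , connected , refl)
      zt , isZt@((Bt , zft , isot , lent) , mint) = minimum (zfSize? noIsolated?) (Bc , zfc , connected⇒noIsolated two-neighbours zfc connc , refl)
      z , isZ@((B , zf , _ , len) , min) = minimum (zfSize? {λ _ → Trivial} λ _ → yes _) (Bt , zft , _ , refl)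
      z≤zt = min zt (Bt , zft , _ , lent)
      zt≤zc = mint zc (Bc , zfc , connected⇒noIsolated two-neighbours zfc connc , lenc)
      zc≤ = ≤-trans (minc (length black) (black , zeroForcing , connected , refl)) length-black
  in z , zt , zc , isZ , isZt , isZc , z≤zt , zt≤zc , zc≤ , λ S-initial →
     let open LowerBound n k S t t<k S-initial using (bound≤)
         ≤z = subst (bound n k t ≤_) len (bound≤ zf)
         ≤zt = ≤-trans ≤z z≤zt
     in ≤-antisym (≤-trans z≤zt (≤-trans zt≤zc zc≤)) ≤z
      , ≤-antisym (≤-trans zt≤zc zc≤) ≤zt
      , ≤-antisym zc≤ (≤-trans ≤zt zt≤zc)
  where
  open Construction n t e S t-max large large′ cfg
  open Graph n k S

theorem4p5 : (n k : ℕ) → 1 ≤ n → 1 ≤ k → (S : Subset k) → Nonempty S →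
    (∀ i → i ∈ S → toℕ i + 2 ≤ k) → (t : ℕ) → IsMax k S t →
    (3 * k ∸ 2 * t) + 1 ≤ n → 2 * k + 1 ≤ n →
    ∃[ z ] ∃[ zt ] ∃[ zc ]
    (IsZ n k S z × IsZt n k S zt × IsZc n k S zc ×
    z ≤ zt × zt ≤ zc × zc ≤ bound n k t ×
    ((∀ i → (i ∈ S ⇔ toℕ i ≤ t)) →
    z ≡ bound n k t × zt ≡ bound n k t × zc ≡ bound n k t))
theorem4p5 n k _ _ S _ small t t-max@((i , i∈S , i≡t) , _) large large′ = with-k k S t-max large large′ k≡
  where
  -- As t ∈ S ⊆ {0, ..., k - 2}, we have d = k - t ≥ 2; the excess d - 2 is the parameter e.
  k≡ : k ≡ t + (2 + (k ∸ (t + 2)))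
  k≡ = sym (trans (sym (+-assoc t 2 _)) (m+[n∸m]≡n (subst (λ m → m + 2 ≤ k) i≡t (small i i∈S))))
  -- The type of S depends on k, so both are generalised before `refl` rewrites k as t + (2 + e).
  with-k : ∀ {e} k S → IsMax k S t → (3 * k ∸ 2 * t) + 1 ≤ n → 2 * k + 1 ≤ n → k ≡ t + (2 + e) → Conclusion n k t S
  with-k {e} _ S t-max large large′ refl = conclusion n t e (config n t e large₁) S t-max large₁
    (subst (_≤ n) (identity′ (t + (2 + e))) large′)
    where
    open ≡-Reasoning
    identity : ∀ t d → 3 * (t + d) ≡ 2 * t + (t + (d + (d + d)))
    identity = solve-∀
    identity′ : ∀ k → 2 * k + 1 ≡ suc (k + k)
    identity′ = solve-∀
    large₁ : suc (t + ((2 + e) + ((2 + e) + (2 + e)))) ≤ n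
    large₁ = subst (_≤ n) (begin
      3 * (t + (2 + e)) ∸ 2 * t + 1                              ≡⟨ cong (λ m → m ∸ 2 * t + 1) (identity t (2 + e)) ⟩
      2 * t + (t + ((2 + e) + ((2 + e) + (2 + e)))) ∸ 2 * t + 1  ≡⟨ cong (_+ 1) (m+n∸m≡n (2 * t) _) ⟩
      t + ((2 + e) + ((2 + e) + (2 + e))) + 1                    ≡⟨ +-comm _ 1 ⟩
      suc (t + ((2 + e) + ((2 + e) + (2 + e)))) ∎) large
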